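{- For any finite forest $F$ and any field $\mathbb{F}$, \[c_2(F)=\mathrm{mr}(F,\mathbb{F})=|F|-p(F).\]
   Context: All graphs are finite and simple; $|F|$ denotes the number of vertices of $F$. A subgraph complementation system for a graph $G=(V,E)$ is a finite collection (family) $\mathscr{C}$ of subsets of $V$ such that, for any two distinct vertices $u,v\in V$, $uv\in E$ if and only if $u$ and $v$ appear together in an odd number of sets in $\mathscr{C}$. The subgraph complementation number $c_2(G)$ is the minimum cardinality of a subgraph complementation system for $G$. A symmetric matrix over a field $\mathbb{F}$ with rows and columns indexed by $V$ fits $G$ if, for distinct $u,v$, its $(u,v)$ entry is nonzero if and only if $uv\in E$ (the diagonal is arbitrary). $\mathrm{mr}(G,\mathbb{F})$ is the minimum rank over $\mathbb{F}$ of a symmetric matrix over $\mathbb{F}$ which fits $G$. The path cover number $p(G)$ is the minimum cardinality of a collection of vertex-disjoint induced paths of $G$ (a single vertex counts as a path) which cover all of the vertices of $G$. -}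

module Defs where

open import Level using (Level; 0ℓ; _⊔_)
open import Algebra.Apartness.Bundles using (HeytingField; HeytingCommutativeRing)
open import Algebra.Bundles using (CommutativeRing)
import Algebra.Properties.Monoid.Sum as MonoidSum
open import Data.Fin.Base using (Fin; toℕ)
open import Data.Fin.Subset using (Subset) renaming (_∈_ to _∈ₛ_)
open import Data.Fin.Subset.Properties using () renaming (_∈?_ to _∈ₛ?_)
open import Data.List.Base using (List; []; _∷_; _∷ʳ_; length; filter; lookup)
open import Data.List.Membership.Propositional using (_∈_)
open import Data.List.Relation.Binary.Disjoint.Propositional using (Disjoint)
open import Data.List.Relation.Unary.All using (All)
open import Data.List.Relation.Unary.AllPairs using (AllPairs)
open import Data.List.Relation.Unary.Any using (Any)
open import Data.List.Relation.Unary.Linked using (Linked)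
open import Data.List.Relation.Unary.Unique.Propositional using (Unique)
open import Data.Nat.Base using (ℕ; _≤_; ∣_-_∣)
open import Data.Nat.DivMod using (_%_)
open import Data.Product.Base using (_×_; ∃; ∃-syntax)
open import Data.Vec.Functional using (Vector)
open import Function.Bundles using (_⇔_)
open import Relation.Binary.Core using (Rel)
open import Relation.Binary.Definitions using (Symmetric; Irreflexive; Decidable)
open import Relation.Binary.PropositionalEquality.Core using (_≡_; _≢_)
open import Relation.Nullary.Decidable using (_×-dec_)
open import Relation.Nullary.Negation using (¬_)

private
  variable
    n r : ℕ

IsMinimum : ∀ {ℓ} → (ℕ → Set ℓ) → ℕ → Set ℓ
IsMinimum P k = P k × (∀ j → P j → k ≤ j)

record Graph (n : ℕ) : Set₁ where
  field
    Adj    : Rel (Fin n) 0ℓ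
    sym    : Symmetric Adj
    irrefl : Irreflexive _≡_ Adj
    adj?   : Decidable Adj

jointCount : List (Subset n) → Fin n → Fin n → ℕ
jointCount 𝒞 u v = length (filter (λ S → (u ∈ₛ? S) ×-dec (v ∈ₛ? S)) 𝒞)

module _ (G : Graph n) where
  open Graph G using (Adj)

  -- The cycle x, xs₀, …, xsₗ, x.
  record IsCycle (x : Fin n) (xs : List (Fin n)) : Set where
    field
      atLeast3 : 2 ≤ length xs
      distinct : Unique (x ∷ xs)
      closed   : Linked Adj (x ∷ (xs ∷ʳ x))

  IsForest : Set
  IsForest = ∀ x xs → ¬ IsCycle x xs

  -- Vertices are listed in the order in which the path visits them.
  record IsInducedPath (xs : List (Fin n)) : Set where
    field
      nonempty : 1 ≤ length xs
      distinct : Unique xs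
      induced  : ∀ i j → Adj (lookup xs i) (lookup xs j) ⇔ ∣ toℕ i - toℕ j ∣ ≡ 1

  record IsPathCover (ps : List (List (Fin n))) : Set where
    field
      paths    : All IsInducedPath ps
      disjoint : AllPairs Disjoint ps
      covers   : ∀ v → Any (v ∈_) ps

  IsPathCoverNumber : ℕ → Set
  IsPathCoverNumber = IsMinimum λ k → ∃[ ps ] (IsPathCover ps × length ps ≡ k)

  -- A list allows repeated sets; deleting two equal copies preserves all
  -- parities, so the minimum below is the same for sets of subsets.
  IsComplementationSystem : List (Subset n) → Set
  IsComplementationSystem 𝒞 =
    ∀ u v → u ≢ v → Adj u v ⇔ jointCount 𝒞 u v % 2 ≡ 1

  IsComplementationNumber : ℕ → Set
  IsComplementationNumber =
    IsMinimum λ k → ∃[ 𝒞 ] (IsComplementationSystem 𝒞 × length 𝒞 ≡ k)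

-- A Heyting field is the constructive notion of a field: x # 0# is the positive
-- form of "x is nonzero".  Classically these are exactly the fields, with # the
-- negation of ≈.
module LinearAlgebra {c ℓ₁ ℓ₂ : Level} (𝔽 : HeytingField c ℓ₁ ℓ₂) where
  open HeytingField 𝔽 using (Carrier; _≈_; _#_; _*_; 0#; heytingCommutativeRing)
  open HeytingCommutativeRing heytingCommutativeRing using (commutativeRing)
  open CommutativeRing commutativeRing using (+-monoid)
  open MonoidSum +-monoid using (sum)

  -- Entry (u , v) of M is M u v.
  SquareMatrix : ℕ → Set c
  SquareMatrix n = Fin n → Fin n → Carrier

  combination : Vector Carrier r → (Fin r → Vector Carrier n) → Vector Carrier n
  combination a b u = sum λ j → a j * b j u

  InSpan : (Fin r → Vector Carrier n) → Vector Carrier n → Set (c ⊔ ℓ₁)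
  InSpan b x = ∃[ a ] (∀ u → x u ≈ combination a b u)

  LinearlyIndependent : (Fin r → Vector Carrier n) → Set (c ⊔ ℓ₁)
  LinearlyIndependent b =
    ∀ a → (∀ u → combination a b u ≈ 0#) → ∀ j → a j ≈ 0#

  columns : SquareMatrix n → Fin n → Vector Carrier n
  columns M v u = M u v

  record IsColumnSpaceBasis (M : SquareMatrix n) (b : Fin r → Vector Carrier n)
      : Set (c ⊔ ℓ₁) where
    field
      inColumnSpace : ∀ j → InSpan (columns M) (b j)
      independent   : LinearlyIndependent b
      spans         : ∀ x → InSpan (columns M) x → InSpan b x

  HasRank : SquareMatrix n → ℕ → Set (c ⊔ ℓ₁)
  HasRank {n} M r = ∃ λ (b : Fin r → Vector Carrier n) → IsColumnSpaceBasis M b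

  record Fits (G : Graph n) (M : SquareMatrix n) : Set (ℓ₁ ⊔ ℓ₂) where
    field
      symmetric : ∀ u v → M u v ≈ M v u
      pattern-⇔ : ∀ u v → u ≢ v → M u v # 0# ⇔ Graph.Adj G u v

  IsMinimumRank : Graph n → ℕ → Set (c ⊔ ℓ₁ ⊔ ℓ₂)
  IsMinimumRank G = IsMinimum λ k → ∃[ M ] (Fits G M × HasRank M k)

{-# OPTIONS --safe #-}

-- A forest is peeled down to nothing by removing an isolated vertex, a leaf v whose
-- neighbour u has at most one other neighbour, or a vertex u together with two leaves
-- a, b at u.  An isolated vertex is a path of its own; a leaf v prolongs the path ending
-- at u; a cherry contributes the path a u b.  This gives a cover by p induced paths.  The
-- edge uv is a single clique and the star at u is the difference of two cliques, so the
-- forest is a signed sum of k cliques, where k + p is the number of vertices.  Read over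
-- 𝔽₂ this is a complementation system, read over 𝔽 it is a fitting matrix whose columns
-- are spanned by k vectors.
--
-- Both are optimal because the removals also yield a zero forcing process with k
-- forces, that is, a triangular k × k submatrix of every fitting matrix.  The cover is
-- optimal because any family of disjoint paths uses at most two edges of a star, hence
-- at most k edges altogether.
module Submission where

open import Defs
open import Algebra.Apartness.Bundles using (HeytingField; HeytingCommutativeRing)
import Algebra.Apartness.Properties.HeytingCommutativeRing as HeytingProperties
open import Algebra.Bundles using (CommutativeRing)
import Algebra.Properties.CommutativeSemigroup as CommutativeSemigroupProperties
import Algebra.Properties.Ring as RingProperties
import Algebra.Properties.Semiring.Sum as SemiringSum
open import Data.Bool.Base using (Bool; true; false; if_then_else_; _∧_; _xor_; not)
open import Data.Bool.Properties using (xor-∧-commutativeRing; ¬-not) renaming (_≟_ to _≟ᵇ_)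
open import Data.Fin.Base using (Fin; zero; suc; toℕ; inject₁; join; splitAt)
open import Data.Fin.Properties
  using (_≟_; injective⇒≤; toℕ-injective; toℕ-inject₁; splitAt-join)
open import Data.Fin.Subset using (Subset; inside; outside)
open import Data.Fin.Subset.Properties using () renaming (_∈?_ to _∈ₛ?_)
open import Data.List.Base
  using (List; []; _∷_; _∷ʳ_; _++_; length; lookup; take; map; concat; allFin)
import Data.List.Membership.DecPropositional as DecMembership
open import Data.List.Membership.Propositional using (_∈_; _∉_; find; lose)
open import Data.List.Membership.Propositional.Properties
  using (∈-∃++; ∈-lookup; ∈-allFin; ∈-AllPairs₂; ∈-++⁺ˡ; ∈-++⁺ʳ; ∈-concat⁻; ∈-concat⁺′)
open import Data.List.Properties using (length-map; length-tabulate; length-++; map-∘; map-id)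
open import Data.List.Relation.Binary.Disjoint.Propositional using (Disjoint)
open import Data.List.Relation.Binary.Permutation.Propositional
  using (_↭_; ↭-refl; ↭-sym; ↭-trans; prep; ↭⇒↭ₛ)
open import Data.List.Relation.Binary.Permutation.Propositional.Properties
  using (shift; ∈-resp-↭; ↭-length; ∷↭∷ʳ; ++⁺ˡ; ++⁺ʳ)
import Data.List.Relation.Binary.Permutation.Setoid.Properties as PermSetoid
open import Data.List.Relation.Unary.All as All using (All; []; _∷_)
import Data.List.Relation.Unary.All.Properties as All
open import Data.List.Relation.Unary.AllPairs as AllPairs using (AllPairs; []; _∷_)
import Data.List.Relation.Unary.AllPairs.Properties as AllPairs
open import Data.List.Relation.Unary.Any as Any using (Any; here; there; any?)
open import Data.List.Relation.Unary.Any.Properties using (lookup-index)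
open import Data.List.Relation.Unary.Linked using (Linked; [-]; _∷_)
open import Data.List.Relation.Unary.Unique.Propositional using (Unique)
open import Data.List.Relation.Unary.Unique.Propositional.Properties
  using (take⁺; allFin⁺; Unique[x∷xs]⇒x∉xs)
open import Data.Nat.Base as ℕ using (ℕ; zero; suc; _≤_; z≤n; s≤s; s≤s⁻¹; ∣_-_∣)
open import Data.Nat.DivMod using (_%_)
import Data.Nat.Properties as ℕ
open import Data.Product.Base using (_×_; _,_; ∃; ∃-syntax; ∃₂; proj₁; proj₂)
open import Data.Sign.Base using (Sign)
open import Data.Sum.Base using (_⊎_; inj₁; inj₂; [_,_]′)
import Data.Vec.Base as Vec
open import Data.Vec.Functional using (Vector; removeAt)
open import Data.Vec.Properties using (lookup∘tabulate)
open import Function.Base using (_∘_)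
open import Function.Bundles using (_⇔_; mk⇔; Equivalence)
open import Level using (Level; 0ℓ; _⊔_)
open import Relation.Binary.Core using (Rel)
open import Relation.Binary.PropositionalEquality.Core
  using (_≡_; _≢_; refl; sym; trans; cong; subst; ≢-sym)
open import Relation.Binary.PropositionalEquality.Properties using () renaming (setoid to ≡-setoid)
import Relation.Binary.Reasoning.Setoid as SetoidReasoning
open import Relation.Nullary.Decidable
  using (Dec; yes; no; does; ¬?; _×-dec_; _⊎-dec_; dec-true; dec-false; decidable-stable)
open import Relation.Nullary.Negation using (¬_; contradiction)
open import Relation.Unary using (Pred; Decidable)

private
  variable
    a ℓ : Level
    X : Set a
    n k p : ℕ

-- Lists without repetition, permutations and linked lists

unique-resp-↭ : {xs ys : List X} → xs ↭ ys → Unique xs → Unique ys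
unique-resp-↭ {X = X} π = PermSetoid.Unique-resp-↭ (≡-setoid X) (↭⇒↭ₛ π)

lookup-injective : {xs : List X} → Unique xs → ∀ i j → lookup xs i ≡ lookup xs j → i ≡ j
lookup-injective (x∉ ∷ u) zero    zero    eq = refl
lookup-injective (x∉ ∷ u) zero    (suc j) eq = contradiction eq (All.lookup x∉ (∈-lookup j))
lookup-injective (x∉ ∷ u) (suc i) zero    eq = contradiction (sym eq) (All.lookup x∉ (∈-lookup i))
lookup-injective (x∉ ∷ u) (suc i) (suc j) eq = cong suc (lookup-injective u i j eq)

unique⇒length≤ : {xs : List (Fin n)} → Unique xs → length xs ≤ n
unique⇒length≤ u = injective⇒≤ λ {i} {j} → lookup-injective u i j

∈⇒↭∷ : {x : X} {xs : List X} → x ∈ xs → ∃[ ys ] xs ↭ x ∷ ys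
∈⇒↭∷ {x = x} x∈xs with ∈-∃++ x∈xs
... | ys , zs , refl = ys ++ zs , shift x ys zs

∈-tail : {x y : X} {xs : List X} → x ∈ y ∷ xs → x ≢ y → x ∈ xs
∈-tail (here x≡y)  x≢y = contradiction x≡y x≢y
∈-tail (there x∈xs) _  = x∈xs

unique-∷ : {x y : X} {xs : List X} → x ≢ y → y ∉ xs → Unique (x ∷ xs) → Unique (y ∷ x ∷ xs)
unique-∷ {xs = xs} x≢y y∉xs uniq =
  (≢-sym x≢y ∷ All.tabulate λ z∈ y≡z → y∉xs (subst (_∈ xs) (sym y≡z) z∈)) ∷ uniq

-- The number m cuts `zs` just behind z, so the prefix ends in z and the step from z to x closes it.
linked-prefix : {R : Rel X ℓ} {x y z : X} {zs : List X} →
  Linked R (y ∷ zs) → z ∈ zs → R z x →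
  ∃[ m ] (1 ≤ length (take m zs) × Linked R (y ∷ (take m zs ∷ʳ x)))
linked-prefix (r ∷ l) (here refl) Rzx = 1 , s≤s z≤n , r ∷ Rzx ∷ [-]
linked-prefix (r ∷ l) (there z∈)  Rzx with linked-prefix l z∈ Rzx
... | m , _ , l′ = suc m , s≤s z≤n , r ∷ l′

-- Peeling a forest

module Peelings (F : Graph n) where
  open Graph F public using (Adj; adj?; irrefl) renaming (sym to adj-sym)
  open DecMembership (_≟_ {n}) using (_∈?_)

  private
    V : Set
    V = Fin n

    variable
      A B : List V
      u v w x y : V

  OnlyNeighbour : List V → V → V → Set
  OnlyNeighbour A v u = ∀ {w} → w ∈ A → Adj v w → w ≡ u

  -- The first number counts forces, cliques and slots, the second counts paths. Vertices are
  -- removed at the head of the list; `reorder` brings them there.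
  data Peeling : List V → ℕ → ℕ → Set where
    empty    : Peeling [] 0 0
    isolated : v ∉ A → (∀ {w} → w ∈ A → ¬ Adj v w) →
               Peeling A k p → Peeling (v ∷ A) k (suc p)
    leaf     : v ∉ A → u ∈ A → Adj u v → OnlyNeighbour A v u →
               (∀ {w w′} → w ∈ A → w′ ∈ A → Adj u w → Adj u w′ → w ≡ w′) →
               Peeling A k p → Peeling (v ∷ A) (suc k) p
    cherry   : ∀ {a b} → Unique (a ∷ u ∷ b ∷ A) → Adj u a → Adj u b →
               OnlyNeighbour (a ∷ u ∷ b ∷ A) a u → OnlyNeighbour (a ∷ u ∷ b ∷ A) b u →
               Peeling A k p → Peeling (a ∷ u ∷ b ∷ A) (2 ℕ.+ k) (suc p)
    reorder  : A ↭ B → Peeling A k p → Peeling B k p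

  adj⇒≢ : Adj u v → u ≢ v
  adj⇒≢ uv refl = irrefl refl uv

  -- A removal found in A but not yet carried out: the vertices still stand anywhere in A, so the
  -- condition on the other neighbours of u has to exclude v explicitly.
  data Step (A : List V) : Set where
    isolated : v ∈ A → (∀ {w} → w ∈ A → ¬ Adj v w) → Step A
    leaf     : v ∈ A → u ∈ A → Adj u v → OnlyNeighbour A v u →
               (∀ {w w′} → w ∈ A → w′ ∈ A → w ≢ v → w′ ≢ v → Adj u w → Adj u w′ → w ≡ w′) →
               Step A
    cherry   : ∀ {a b} → a ∈ A → b ∈ A → u ∈ A → a ≢ b → Adj u a → Adj u b →
               OnlyNeighbour A a u → OnlyNeighbour A b u → Step A

  module _ (forest : IsForest F) where

    -- A chord from x to z, together with the stretch of the path from x through y to z, is a cycle.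
    -- It has at least three vertices because z comes after y.
    no-chord : ∀ {z zs} → Linked Adj (x ∷ y ∷ zs) → Unique (x ∷ y ∷ zs) → z ∈ zs → ¬ Adj x z
    no-chord {x = x} {y = y} {zs = zs} (xy ∷ l) uniq z∈ xz with linked-prefix l z∈ (adj-sym xz)
    ... | m , 1≤ , l′ = forest x (y ∷ take m zs) record
      { atLeast3 = s≤s 1≤
      ; distinct = take⁺ (2 ℕ.+ m) uniq
      ; closed   = xy ∷ l′
      }

    neighbour-on-path : ∀ {z zs} → Linked Adj (x ∷ y ∷ zs) → Unique (x ∷ y ∷ zs) →
      z ∈ y ∷ zs → Adj x z → z ≡ y
    neighbour-on-path l uniq (here z≡y) xz = z≡y
    neighbour-on-path l uniq (there z∈) xz = contradiction xz (no-chord l uniq z∈)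

    on-path-unique : ∀ {xs z} → Linked Adj (x ∷ xs) → Unique (x ∷ xs) →
      y ∈ xs → z ∈ xs → Adj x y → Adj x z → y ≡ z
    on-path-unique {xs = _ ∷ _} l uniq y∈ z∈ xy xz =
      trans (neighbour-on-path l uniq y∈ xy) (sym (neighbour-on-path l uniq z∈ xz))

    module _ (A : List V) where

      Onward : V → List V → V → Set
      Onward x xs w = Adj x w × w ∉ xs

      onward? : ∀ x xs w → Dec (Onward x xs w)
      onward? x xs w = adj? x w ×-dec ¬? (w ∈? xs)

      Blocked : V → List V → Set
      Blocked x xs = ¬ Any (λ w → Onward x xs w × Any (Onward w (x ∷ xs)) A) A

      -- A neighbour z of y off the path would allow two further steps. A neighbour on the path
      -- other than x would close a cycle, since y prolongs the path at x.
      blocked⇒leaf : ∀ {xs} → Linked Adj (x ∷ xs) → Unique (x ∷ xs) → Blocked x xs →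
                     y ∈ A → Onward x xs y → OnlyNeighbour A y x
      blocked⇒leaf {x} {y} {xs} l uniq blocked y∈A oy@(xy , y∉xs) {z} z∈A yz with z ∈? (x ∷ xs)
      ... | yes z∈ = neighbour-on-path (adj-sym xy ∷ l) (unique-∷ (adj⇒≢ xy) y∉xs uniq) z∈ yz
      ... | no z∉  = contradiction (lose y∈A (oy , lose z∈A (yz , z∉))) blocked

      -- The path x ∷ xs is prolonged at x as long as some neighbour of x has a
      -- further neighbour.  When this is no longer possible, all neighbours of x off
      -- the path are leaves, and x has at most one neighbour on it.
      search : ∀ fuel x xs → length xs ℕ.+ fuel ≡ n → Linked Adj (x ∷ xs) → Unique (x ∷ xs) →
               x ∈ A → w ∈ A → Onward x xs w → Step A
      -- With the fuel spent, the path would have n + 1 distinct vertices.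
      search zero x xs len _ uniq _ _ _ =
        contradiction (ℕ.≤-trans (unique⇒length≤ uniq)
          (ℕ.≤-reflexive (trans (sym len) (ℕ.+-identityʳ _)))) ℕ.1+n≰n
      search {w} (suc fuel) x xs len l uniq x∈A w∈A ow@(xw , w∉xs)
        with any? (λ w → onward? x xs w ×-dec any? (onward? w (x ∷ xs)) A) A
      ... | yes some with find some
      ...   | y , y∈A , (xy , y∉xs) , more with find more
      ...     | z , z∈A , oz =
        search fuel y (x ∷ xs) (trans (sym (ℕ.+-suc _ _)) len) (adj-sym xy ∷ l)
          (unique-∷ (adj⇒≢ xy) y∉xs uniq) y∈A z∈A oz
      -- Now every neighbour of x off the path is a leaf. A second one besides w makes a cherry;
      -- otherwise the remaining neighbours of x lie on the path, where there is at most one.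
      search {w} (suc fuel) x xs len l uniq x∈A w∈A ow@(xw , w∉xs)
          | no blocked with any? (λ w′ → onward? x xs w′ ×-dec ¬? (w ≟ w′)) A
      ...   | yes some with find some
      ...     | w′ , w′∈A , ow′@(xw′ , _) , w≢w′ =
        cherry w∈A w′∈A x∈A w≢w′ xw xw′
          (blocked⇒leaf l uniq blocked w∈A ow) (blocked⇒leaf l uniq blocked w′∈A ow′)
      search {w} (suc fuel) x xs len l uniq x∈A w∈A ow@(xw , w∉xs)
          | no blocked | no only =
        leaf w∈A x∈A xw (blocked⇒leaf l uniq blocked w∈A ow)
          λ y∈A z∈A y≢w z≢w xy xz →
            on-path-unique l uniq (on-path y∈A y≢w xy) (on-path z∈A z≢w xz) xy xz
        where
        on-path : y ∈ A → y ≢ w → Adj x y → y ∈ xs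
        on-path {y} y∈A y≢w xy with y ∈? xs
        ... | yes y∈xs = y∈xs
        ... | no y∉xs  = contradiction (lose y∈A ((xy , y∉xs) , ≢-sym y≢w)) only

      step : v ∈ A → Step A
      step {v} v∈A with any? (adj? v) A
      ... | no none = isolated v∈A λ w∈A vw → none (lose w∈A vw)
      ... | yes some with find some
      ...   | w , w∈A , vw = search n v [] refl [-] ([] ∷ []) v∈A w∈A (vw , λ ())

    -- The recursion is on a bound m for the length, since the remaining vertices are known only up
    -- to a permutation of A and a cherry takes away three at once.
    peeling : ∀ m A → length A ≤ m → Unique A → ∃₂ (Peeling A)
    peeling m [] _ _ = 0 , 0 , empty
    peeling (suc m) A@(_ ∷ _) len uniq with step A (here refl)
    ... | isolated v∈A alone with ∈⇒↭∷ v∈A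
    ...   | A′ , π with unique-resp-↭ π uniq
    ...     | uniq′ with peeling m A′ (s≤s⁻¹ (subst (_≤ suc m) (↭-length π) len)) (AllPairs.tail uniq′)
    ...       | k , p , d = k , suc p , reorder (↭-sym π)
      (isolated (Unique[x∷xs]⇒x∉xs uniq′) (λ w∈ → alone (∈-resp-↭ (↭-sym π) (there w∈))) d)
    peeling (suc m) A@(_ ∷ _) len uniq
      | leaf v∈A u∈A uv only-v at-most-one with ∈⇒↭∷ v∈A
    ...   | A′ , π with unique-resp-↭ π uniq
    ...     | uniq′@(v≢ ∷ _) with peeling m A′ (s≤s⁻¹ (subst (_≤ suc m) (↭-length π) len)) (AllPairs.tail uniq′)
    ...       | k , p , d = suc k , p , reorder (↭-sym π)
      (leaf (Unique[x∷xs]⇒x∉xs uniq′) (∈-tail (∈-resp-↭ π u∈A) (adj⇒≢ uv)) uv (only-v ∘ back)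
        (λ w∈ w′∈ → at-most-one (back w∈) (back w′∈)
                      (≢-sym (All.lookup v≢ w∈)) (≢-sym (All.lookup v≢ w′∈)))
        d)
      where
      back : w ∈ A′ → w ∈ A
      back w∈ = ∈-resp-↭ (↭-sym π) (there w∈)
    peeling (suc m) A@(_ ∷ _) len uniq
      | cherry {u} {a} {b} a∈A b∈A u∈A a≢b ua ub only-a only-b with ∈⇒↭∷ a∈A
    ...   | A₁ , π₁ with ∈⇒↭∷ (∈-tail (∈-resp-↭ π₁ u∈A) (adj⇒≢ ua))
    ...     | A₂ , π₂ with ∈⇒↭∷ (∈-tail (∈-resp-↭ π₂ (∈-tail (∈-resp-↭ π₁ b∈A) (≢-sym a≢b))) (≢-sym (adj⇒≢ ub)))
    ...       | A₃ , π₃ with ↭-trans π₁ (prep a (↭-trans π₂ (prep u π₃)))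
    ...         | π with unique-resp-↭ π uniq
    ...           | uniq′ with peeling m A₃
                    (ℕ.≤-trans (ℕ.≤-trans (ℕ.n≤1+n _) (ℕ.n≤1+n _)) (s≤s⁻¹ (subst (_≤ suc m) (↭-length π) len)))
                    (AllPairs.tail (AllPairs.tail (AllPairs.tail uniq′)))
    ...             | k , p , d = 2 ℕ.+ k , suc p , reorder (↭-sym π)
      (cherry uniq′ ua ub (only-a ∘ ∈-resp-↭ (↭-sym π)) (only-b ∘ ∈-resp-↭ (↭-sym π)) d)

  -- Each removal raises k + p by the number of vertices removed: 0 + 1 for an isolated vertex, 1 +
  -- 0 for a leaf, 2 + 1 for a cherry.
  peeling-length : Peeling A k p → length A ≡ k ℕ.+ p
  peeling-length empty = refl
  peeling-length {k = k} (isolated _ _ d) = trans (cong suc (peeling-length d)) (sym (ℕ.+-suc k _))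
  peeling-length (leaf _ _ _ _ _ d) = cong suc (peeling-length d)
  peeling-length (cherry {k = k} _ _ _ _ _ d) = 
    cong (2 ℕ.+_) (trans (cong suc (peeling-length d)) (sym (ℕ.+-suc k _)))
  peeling-length (reorder π d) = trans (sym (↭-length π)) (peeling-length d)

-- Forces, paths and slots

module Chains (F : Graph n) where
  open Peelings F

  private
    V : Set
    V = Fin n

    variable
      A : List V
      u v w x y : V

  Force : Set
  Force = V × V

  -- This makes the entry in row v and column w vanish in every fitting matrix. The diagonal is
  -- arbitrary there, so non-adjacency has to be accompanied by v ≢ w.
  Precedes : Force → Force → Set
  Precedes (v , _) (_ , w) = v ≢ w × ¬ Adj v w

  -- A zero forcing process in which v forces w for each (v , w), in this order: the
  -- rows v and columns w of a fitting matrix form a triangular submatrix with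
  -- nonzero diagonal.
  record Chain (fs : List Force) : Set where
    constructor chain
    field
      adjacent : All (λ (v , w) → Adj v w) fs
      ordered  : AllPairs Precedes fs

  ChainIn : List V → ℕ → Set
  ChainIn A k = ∃[ fs ] (Chain fs × All (λ (v , w) → v ∈ A × w ∈ A) fs × length fs ≡ k)

  -- New forces are put at the two ends of the old chain. A force out of a leaf goes first, as the
  -- leaf sees none of the later targets; a force into a leaf goes last, as no earlier source sees
  -- the leaf.
  peeling-chain : Peeling A k p → ChainIn A k
  peeling-chain empty = [] , chain [] [] , [] , refl
  peeling-chain (isolated _ _ d) with peeling-chain d
  ... | fs , c , inA , len = fs , c , All.map (λ (v∈ , w∈) → there v∈ , there w∈) inA , len
  -- The new force is u → v, performed last, if u is not yet the source of a force.
  -- Otherwise u cannot be a target as well, since it has at most one neighbour in A, and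
  -- v → u can be performed first.
  peeling-chain {v ∷ A} (leaf {u = u} v∉A u∈A uv only-v at-most-one d) with peeling-chain d
  ... | fs , chain adjs ord , inA , len with any? (λ (x , _) → u ≟ x) fs
  ...   | no u-idle = fs ++ (u , v) ∷ [] , chain (All.++⁺ adjs (uv ∷ []))
            (AllPairs.++⁺ ord ([] ∷ []) (All.tabulate λ f∈ → before f∈ ∷ [])) ,
            All.++⁺ (All.map (λ (v∈ , w∈) → there v∈ , there w∈) inA) ((there u∈A , here refl) ∷ []) ,
            trans (length-++ fs) (trans (ℕ.+-comm _ 1) (cong suc len))
    where
    before : ∀ {f} → f ∈ fs → Precedes f (u , v)
    before {x , _} f∈ with All.lookup inA f∈
    ... | x∈A , _ = (λ x≡v → v∉A (subst (_∈ A) x≡v x∈A)) ,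
      λ xv → u-idle (lose f∈ (sym (only-v x∈A (adj-sym xv))))
  ...   | yes u-forces with find u-forces
  ...     | (_ , w) , uw∈ , refl = (v , u) ∷ fs , chain (adj-sym uv ∷ adjs) (All.tabulate after ∷ ord) ,
            (here refl , there u∈A) ∷ All.map (λ (v∈ , w∈) → there v∈ , there w∈) inA , cong suc len
    where
    -- If x forced u, then x and w would both be the one neighbour of u in A. The forces w → u and u
    -- → w cannot stand in either order, because the source of the earlier one is the target of the
    -- later one.
    unforced : ∀ {x} → (x , u) ∉ fs
    unforced {x} xu∈ with All.lookup adjs uw∈ | All.lookup adjs xu∈
    ... | uw | xu with at-most-one (proj₁ (All.lookup inA xu∈)) (proj₂ (All.lookup inA uw∈)) (adj-sym xu) uw
    ...   | refl with ∈-AllPairs₂ ord xu∈ uw∈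
    ...     | inj₁ refl               = irrefl refl uw
    ...     | inj₂ (inj₁ (w≢w , _)) = w≢w refl
    ...     | inj₂ (inj₂ (u≢u , _)) = u≢u refl
    after : ∀ {f} → f ∈ fs → Precedes (v , u) f
    after {_ , y} f∈ with All.lookup inA f∈
    ... | _ , y∈A = (λ v≡y → v∉A (subst (_∈ A) (sym v≡y) y∈A)) ,
      λ vy → unforced (subst (λ z → (_ , z) ∈ fs) (only-v y∈A vy) f∈)
  -- The leaf a forces u first, and u forces the leaf b last.
  peeling-chain (cherry {u = u} {a = a} {b = b}
      ((_ ∷ a≢b ∷ a≢A) ∷ (u≢b ∷ u≢A) ∷ (b≢A ∷ _)) ua ub only-a only-b d)
    with peeling-chain d
  ... | fs , chain adjs ord , inA , len =
    (a , u) ∷ fs ++ (u , b) ∷ [] ,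
    chain (adj-sym ua ∷ All.++⁺ adjs (ub ∷ []))
      (All.++⁺ (All.tabulate λ f∈ → let y∈A = proj₂ (All.lookup inA f∈) in
                  All.lookup a≢A y∈A , λ ay → All.lookup u≢A y∈A (sym (only-a (there (there (there y∈A))) ay)))
               ((a≢b , λ ab → u≢b (sym (only-a (there (there (here refl))) ab))) ∷ [])
       ∷ AllPairs.++⁺ ord ([] ∷ []) (All.tabulate λ f∈ → let x∈A = proj₁ (All.lookup inA f∈) in
           (≢-sym (All.lookup b≢A x∈A) ,
            λ xb → All.lookup u≢A x∈A (sym (only-b (there (there (there x∈A))) (adj-sym xb)))) ∷ [])) ,
    (here refl , there (here refl)) ∷
    All.++⁺ (All.map (λ (v∈ , w∈) → there (there (there v∈)) , there (there (there w∈))) inA)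
      ((there (here refl) , there (there (here refl))) ∷ []) ,
    cong suc (trans (length-++ fs) (trans (ℕ.+-comm _ 1) (cong suc len)))
  peeling-chain (reorder π d) with peeling-chain d
  ... | fs , c , inA , len = fs , c , All.map (λ (v∈ , w∈) → ∈-resp-↭ π v∈ , ∈-resp-↭ π w∈) inA , len

  -- The recursive counterpart of `IsInducedPath`: each vertex is compared only with those after it,
  -- which suits building a path by prepending.
  data InducedPath : List V → Set where
    [-] : InducedPath (x ∷ [])
    _∷_ : ∀ {x y zs} → Adj x y × x ≢ y × All (λ z → x ≢ z × ¬ Adj x z) zs →
          InducedPath (y ∷ zs) → InducedPath (x ∷ y ∷ zs)

  inducedPath⇒unique : ∀ {xs} → InducedPath xs → Unique xs
  inducedPath⇒unique [-] = [] ∷ []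
  inducedPath⇒unique ((_ , x≢y , far) ∷ path) = (x≢y ∷ All.map proj₁ far) ∷ inducedPath⇒unique path

  inducedPath-adj : ∀ {xs} → InducedPath xs → ∀ i j →
    Adj (lookup xs i) (lookup xs j) ⇔ ∣ toℕ i - toℕ j ∣ ≡ 1
  inducedPath-adj [-] zero zero = mk⇔ (λ e → contradiction e (irrefl refl)) λ ()
  inducedPath-adj (_ ∷ _) zero zero = mk⇔ (λ e → contradiction e (irrefl refl)) λ ()
  inducedPath-adj ((xy , _) ∷ _) zero (suc zero) = mk⇔ (λ _ → refl) λ _ → xy
  inducedPath-adj ((xy , _) ∷ _) (suc zero) zero = mk⇔ (λ _ → refl) λ _ → adj-sym xy
  inducedPath-adj ((_ , _ , far) ∷ _) zero (suc (suc j)) =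
    mk⇔ (λ e → contradiction e (proj₂ (All.lookup far (∈-lookup j)))) λ ()
  inducedPath-adj ((_ , _ , far) ∷ _) (suc (suc i)) zero =
    mk⇔ (λ e → contradiction (adj-sym e) (proj₂ (All.lookup far (∈-lookup i)))) λ ()
  inducedPath-adj (_ ∷ path) (suc i) (suc j) = inducedPath-adj path i j

  inducedPath⇒isInducedPath : ∀ {xs} → InducedPath xs → IsInducedPath F xs
  inducedPath⇒isInducedPath path = record
    { nonempty = nonempty path
    ; distinct = inducedPath⇒unique path
    ; induced  = inducedPath-adj path
    }
    where
    nonempty : ∀ {xs} → InducedPath xs → 1 ≤ length xs
    nonempty [-]     = s≤s z≤n
    nonempty (_ ∷ _) = s≤s z≤n

  -- xs is prolonged by v at its vertex u, which has to be an end of xs.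
  record Prolongable (xs : List V) (u v : V) : Set where
    field
      new         : v ∉ xs
      only        : OnlyNeighbour xs v u
      at-most-one : ∀ {w w′} → w ∈ xs → w′ ∈ xs → Adj u w → Adj u w′ → w ≡ w′

  Prolongable-tail : ∀ {xs} → Prolongable (x ∷ xs) u v → Prolongable xs u v
  Prolongable-tail pr = record
    { new         = new ∘ there
    ; only        = only ∘ there
    ; at-most-one = λ w∈ w′∈ → at-most-one (there w∈) (there w′∈)
    }
    where open Prolongable pr

  -- Here u is not the first vertex. An inner vertex would have two neighbours on the path, contrary
  -- to `at-most-one`, so u is the last vertex and v can be appended.
  prolong-last : ∀ {xs} → InducedPath (x ∷ xs) → u ∈ xs → Adj u v → Prolongable (x ∷ xs) u v →
                 InducedPath (x ∷ xs ∷ʳ v)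
  prolong-last {x} {u} {v} path@((xy , x≢y , far) ∷ path′) u∈ uv pr =
    (xy , x≢y , All.++⁺ far (far-v ∷ [])) ∷ rest path u∈ pr
    where
    open Prolongable pr
    far-v : x ≢ v × ¬ Adj x v
    far-v = (λ x≡v → new (here (sym x≡v))) , λ xv →
      All.lookup (AllPairs.head (inducedPath⇒unique path)) u∈ (only (here refl) (adj-sym xv))
    rest : ∀ {y zs} → InducedPath (x ∷ y ∷ zs) → u ∈ y ∷ zs → Prolongable (x ∷ y ∷ zs) u v →
           InducedPath (y ∷ zs ∷ʳ v)
    rest {zs = []} _ (here refl) _ = (uv , adj⇒≢ uv , []) ∷ [-]
    rest {zs = _ ∷ _} ((xu , _ , far) ∷ (uz , _) ∷ _) (here refl) pr =
      contradiction (Prolongable.at-most-one pr (here refl) (there (there (here refl))) (adj-sym xu) uz)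
        (proj₁ (All.head far))
    rest (_ ∷ path′) (there u∈) pr = prolong-last path′ u∈ uv (Prolongable-tail pr)

  prolong : ∀ {xs} → InducedPath xs → u ∈ xs → Adj u v → Prolongable xs u v →
            ∃[ ys ] (InducedPath ys × ys ↭ v ∷ xs)
  prolong {v = v} {x ∷ xs} path (here refl) uv pr = v ∷ x ∷ xs ,
    ((adj-sym uv , (λ v≡u → new (here v≡u)) , All.tabulate λ z∈ →
        (λ v≡z → new (there (subst (_∈ xs) (sym v≡z) z∈))) ,
        λ vz → All.lookup (AllPairs.head (inducedPath⇒unique path)) z∈ (sym (only (there z∈) vz))) ∷ path) ,
    ↭-refl
    where open Prolongable pr
  prolong {v = v} {x ∷ xs} path (there u∈) uv pr =
    x ∷ xs ∷ʳ v , prolong-last path u∈ uv pr , ↭-sym (∷↭∷ʳ v (x ∷ xs))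

  prolong-in : ∀ {xss} → All InducedPath xss → Any (u ∈_) xss → Adj u v → Prolongable (concat xss) u v →
    ∃[ yss ] (All InducedPath yss × length yss ≡ length xss × concat yss ↭ v ∷ concat xss)
  prolong-in {xss = xs ∷ xss} (path ∷ paths) (here u∈) uv pr
    with prolong path u∈ uv record
      { new = new ∘ ∈-++⁺ˡ ; only = only ∘ ∈-++⁺ˡ
      ; at-most-one = λ w∈ w′∈ → at-most-one (∈-++⁺ˡ w∈) (∈-++⁺ˡ w′∈) }
    where open Prolongable pr
  ... | ys , path′ , π = ys ∷ xss , path′ ∷ paths , refl , ++⁺ʳ (concat xss) π
  prolong-in {v = v} {xss = xs ∷ xss} (path ∷ paths) (there u∈) uv pr
    with prolong-in paths u∈ uv record
      { new = new ∘ ∈-++⁺ʳ xs ; only = only ∘ ∈-++⁺ʳ xs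
      ; at-most-one = λ w∈ w′∈ → at-most-one (∈-++⁺ʳ xs w∈) (∈-++⁺ʳ xs w′∈) }
    where open Prolongable pr
  ... | yss , paths′ , len , π = xs ∷ yss , path ∷ paths′ , cong suc len ,
    ↭-trans (++⁺ˡ xs π) (shift v xs (concat xss))

  -- The permutation from `concat ps` to A carries both requirements on a cover: every vertex of A
  -- occurs, and the paths are disjoint as soon as A has no repetitions.
  peeling-cover : Peeling A k p → ∃[ ps ] (All InducedPath ps × length ps ≡ p × concat ps ↭ A)
  peeling-cover empty = [] , [] , refl , ↭-refl
  peeling-cover {v ∷ _} (isolated _ _ d) with peeling-cover d
  ... | ps , paths , len , π = (v ∷ []) ∷ ps , [-] ∷ paths , cong suc len , prep v π
  peeling-cover {v ∷ _} (leaf v∉A u∈A uv only-v at-most-one d) with peeling-cover d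
  ... | ps , paths , len , π
    with prolong-in paths (∈-concat⁻ ps (∈-resp-↭ (↭-sym π) u∈A)) uv record
      { new = v∉A ∘ ∈-resp-↭ π ; only = only-v ∘ ∈-resp-↭ π
      ; at-most-one = λ w∈ w′∈ → at-most-one (∈-resp-↭ π w∈) (∈-resp-↭ π w′∈) }
  ...   | ps′ , paths′ , len′ , π′ = ps′ , paths′ , trans len′ len , ↭-trans π′ (prep v π)
  peeling-cover (cherry {u = u} {a = a} {b} ((a≢u ∷ a≢b ∷ _) ∷ (u≢b ∷ _) ∷ _) ua ub only-a _ d) with peeling-cover d
  ... | ps , paths , len , π = (a ∷ u ∷ b ∷ []) ∷ ps ,
    ((adj-sym ua , a≢u , (a≢b , λ ab → u≢b (sym (only-a (there (there (here refl))) ab))) ∷ []) ∷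
     (ub , u≢b , []) ∷ [-]) ∷ paths ,
    cong suc len , prep a (prep u (prep b π))
  peeling-cover (reorder π′ d) with peeling-cover d
  ... | ps , paths , len , π = ps , paths , len , ↭-trans π π′

  unique-concat⇒disjoint : ∀ {pss : List (List V)} → Unique (concat pss) → AllPairs Disjoint pss
  unique-concat⇒disjoint {[]} _ = []
  unique-concat⇒disjoint {ps ∷ pss} uniq = go ps uniq ∷ unique-concat⇒disjoint (rest ps uniq)
    where
    rest : ∀ ps {qs} → Unique (ps ++ qs) → Unique qs
    rest [] uniq = uniq
    rest (x ∷ ps) (_ ∷ uniq) = rest ps uniq
    separate : ∀ ps {qs} → Unique (ps ++ qs) → ∀ {x} → x ∈ ps → x ∉ qs
    separate (x ∷ ps) (x∉ ∷ _) (here refl) x∈qs = All.lookup x∉ (∈-++⁺ʳ ps x∈qs) refl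
    separate (x ∷ ps) (_ ∷ uniq) (there x∈ps) x∈qs = separate ps uniq x∈ps x∈qs
    go : ∀ ps → Unique (ps ++ concat pss) → All (Disjoint ps) pss
    go ps uniq = All.tabulate λ qs∈ (x∈ps , x∈qs) → separate ps uniq x∈ps (∈-concat⁺′ x∈qs qs∈)

  pathCover : Peeling (allFin n) k p → ∃[ ps ] (IsPathCover F ps × length ps ≡ p)
  pathCover d with peeling-cover d
  ... | ps , paths , len , π = ps , record
    { paths    = All.map inducedPath⇒isInducedPath paths
    ; disjoint = unique-concat⇒disjoint (unique-resp-↭ (↭-sym π) (allFin⁺ n))
    ; covers   = λ v → ∈-concat⁻ ps (∈-resp-↭ (↭-sym π) (∈-allFin v))
    } , len

  -- A slot stands for one unit of k; a star with centre u uses two of them, one for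
  -- the path leaving u and one for the path entering u.
  data Slot : Set where
    leaving entering : V → Slot
    between          : V → V → Slot

  -- Edges are directed the way a path traverses them. A slot `between` accepts both directions,
  -- since disjoint paths traverse an edge in at most one of them.
  data Fills : V → V → Slot → Set where
    leaves  : Fills u v (leaving u)
    enters  : Fills u v (entering v)
    along   : Fills u v (between u v)
    against : Fills u v (between v u)

  Slots : List V → ℕ → Set
  Slots A k = ∃[ ss ] (length ss ≡ k × (∀ {x y} → x ∈ A → y ∈ A → Adj x y → Any (Fills x y) ss))

  -- The only edge lost with a leaf v is the one to u. A cherry loses exactly the edges at u, each
  -- of which leaves or enters u.
  peeling-slots : Peeling A k p → Slots A k
  peeling-slots empty = [] , refl , λ ()
  peeling-slots {v ∷ A} (isolated v∉A alone d) with peeling-slots d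
  ... | ss , len , fill = ss , len , fill′
    where
    fill′ : ∀ {x y} → x ∈ v ∷ A → y ∈ v ∷ A → Adj x y → Any (Fills x y) ss
    fill′ (here refl) (here refl) xy = contradiction xy (irrefl refl)
    fill′ (here refl) (there y∈)  xy = contradiction xy (alone y∈)
    fill′ (there x∈)  (here refl) xy = contradiction (adj-sym xy) (alone x∈)
    fill′ (there x∈)  (there y∈)  xy = fill x∈ y∈ xy
  peeling-slots {v ∷ A} (leaf {u = u} v∉A _ uv only-v _ d) with peeling-slots d
  ... | ss , len , fill = between u v ∷ ss , cong suc len , fill′
    where
    fill′ : ∀ {x y} → x ∈ v ∷ A → y ∈ v ∷ A → Adj x y → Any (Fills x y) (between u v ∷ ss)
    fill′ (here refl) (here refl) xy = contradiction xy (irrefl refl)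
    fill′ (here refl) (there y∈)  xy with refl ← only-v y∈ xy = here against
    fill′ (there x∈)  (here refl) xy with refl ← only-v x∈ (adj-sym xy) = here along
    fill′ (there x∈)  (there y∈)  xy = there (fill x∈ y∈ xy)
  peeling-slots {a ∷ u ∷ b ∷ A} (cherry _ _ _ only-a only-b d) with peeling-slots d
  ... | ss , len , fill = leaving u ∷ entering u ∷ ss , cong (2 ℕ.+_) len , fill′
    where
    fill′ : ∀ {x y} → x ∈ a ∷ u ∷ b ∷ A → y ∈ a ∷ u ∷ b ∷ A → Adj x y → Any (Fills x y) (leaving u ∷ entering u ∷ ss)
    fill′ (here refl) y∈ xy with refl ← only-a y∈ xy = there (here enters)
    fill′ (there (here refl)) y∈ xy = here leaves
    fill′ (there (there (here refl))) y∈ xy with refl ← only-b y∈ xy = there (here enters)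
    fill′ x∈ (here refl) xy with refl ← only-a x∈ (adj-sym xy) = here leaves
    fill′ x∈ (there (here refl)) xy = there (here enters)
    fill′ x∈ (there (there (here refl))) xy with refl ← only-b x∈ (adj-sym xy) = here leaves
    fill′ (there (there (there x∈))) (there (there (there y∈))) xy = there (there (fill x∈ y∈ xy))
  peeling-slots (reorder π d) with peeling-slots d
  ... | ss , len , fill = ss , len , λ x∈ y∈ → fill (∈-resp-↭ (↭-sym π) x∈) (∈-resp-↭ (↭-sym π) y∈)

-- Path covers have at least p paths

lookup-disjoint : {xss : List (List X)} {x : X} → AllPairs Disjoint xss →
  ∀ i j → x ∈ lookup xss i → x ∈ lookup xss j → i ≡ j
lookup-disjoint (_ ∷ _)  zero    zero    _ _ = refl
lookup-disjoint (d ∷ _)  zero    (suc j) x∈ x∈′ = contradiction (x∈ , x∈′) (All.lookup d (∈-lookup j))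
lookup-disjoint (d ∷ _)  (suc i) zero    x∈ x∈′ = contradiction (x∈′ , x∈) (All.lookup d (∈-lookup i))
lookup-disjoint (_ ∷ ds) (suc i) (suc j) x∈ x∈′ = cong suc (lookup-disjoint ds i j x∈ x∈′)

∣n-1+n∣≡1 : ∀ m → ∣ m - suc m ∣ ≡ 1
∣n-1+n∣≡1 zero    = refl
∣n-1+n∣≡1 (suc m) = ∣n-1+n∣≡1 m

-- Sending a vertex to its path if it is the first one there, and otherwise to a slot
-- filled by the edge entering it along the path, is injective.
module Counting (F : Graph n) where
  open Peelings F
  open Chains F

  private
    V : Set
    V = Fin n

    variable
      u v w x y : V

  module _ {ps : List (List V)} (cover : IsPathCover F ps)
           {ss : List Slot} (fill : ∀ {x y} → Adj x y → Any (Fills x y) ss) where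
    open IsPathCover cover

    -- Positions are natural numbers, so that positions on two paths can be compared before the
    -- paths are known to coincide.
    At : V → Fin (length ps) → ℕ → Set
    At v i t = ∃[ t′ ] (toℕ t′ ≡ t × lookup (lookup ps i) t′ ≡ v)

    path-at : ∀ i → IsInducedPath F (lookup ps i)
    path-at i = All.lookup paths (∈-lookup i)

    at⇒∈ : ∀ {i t} → At v i t → v ∈ lookup ps i
    at⇒∈ (t , _ , refl) = ∈-lookup t

    at-functional : ∀ {i j s t} → At v i s → At v j t → i ≡ j × s ≡ t
    at-functional {i = i} {j} a b with lookup-disjoint disjoint i j (at⇒∈ a) (at⇒∈ b)
    at-functional {i = i} (_ , refl , eq) (_ , refl , eq′) | refl = refl ,
      cong toℕ (lookup-injective (IsInducedPath.distinct (path-at i)) _ _ (trans eq (sym eq′)))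

    at-injective : ∀ {i t} → At v i t → At w i t → v ≡ w
    at-injective {i = i} (_ , s≡ , refl) (_ , t≡ , refl) =
      cong (lookup (lookup ps i)) (toℕ-injective (trans s≡ (sym t≡)))

    at : ∀ v → ∃₂ (At v)
    at v = _ , _ , Any.index v∈ , refl , sym (lookup-index v∈)
      where
      v∈ : v ∈ lookup ps (Any.index (covers v))
      v∈ = lookup-index (covers v)

    predecessor : ∀ {i t} → At w i (suc t) → ∃[ v ] (At v i t × Adj v w)
    predecessor {i = i} (t , t≡ , refl) = go (path-at i) t t≡
      where
      go : ∀ {xs} → IsInducedPath F xs → (t : Fin (length xs)) → ∀ {s} → toℕ t ≡ suc s →
        ∃[ v ] ((∃[ t′ ] (toℕ t′ ≡ s × lookup xs t′ ≡ v)) × Adj v (lookup xs t))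
      go {_ ∷ _ ∷ _} path (suc t) refl = _ , (inject₁ t , toℕ-inject₁ t , refl) ,
        Equivalence.from (IsInducedPath.induced path (inject₁ t) (suc t))
          (trans (cong (λ s → ∣ s - suc (toℕ t) ∣) (toℕ-inject₁ t)) (∣n-1+n∣≡1 (toℕ t)))

    data Code (w : V) : Fin (length ps) ⊎ Fin (length ss) → Set where
      first : ∀ {i} → At w i 0 → Code w (inj₁ i)
      later : ∀ {v i t s} → At v i t → At w i (suc t) → Fills v w (lookup ss s) → Code w (inj₂ s)

    code : ∀ w → ∃ (Code w)
    code w with at w
    ... | i , zero  , w-at = inj₁ i , first w-at
    ... | i , suc t , w-at with predecessor w-at
    ...   | v , v-at , vw = inj₂ (Any.index (fill vw)) , later v-at w-at (lookup-index (fill vw))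

    -- A slot determines the vertex entered: for `leaving` it is the one behind v on the only path
    -- through v, for `entering` it is named by the slot. For `between`, opposite traversals would
    -- put each of two vertices directly before the other.
    fills-functional : ∀ {v v′ w w′ i i′ t t′ s} → At v i t → At w i (suc t) → Fills v w s →
      At v′ i′ t′ → At w′ i′ (suc t′) → Fills v′ w′ s → w ≡ w′
    fills-functional v-at w-at leaves v′-at w′-at leaves with refl , refl ← at-functional v-at v′-at =
      at-injective w-at w′-at
    fills-functional _ _ enters _ _ enters = refl
    fills-functional _ _ along _ _ along = refl
    fills-functional _ _ against _ _ against = refl
    fills-functional v-at w-at along w-at′ v-at′ against
      with refl , refl ← at-functional v-at v-at′ | _ , () ← at-functional w-at w-at′
    fills-functional v-at w-at against w-at′ v-at′ along
      with refl , refl ← at-functional v-at v-at′ | _ , () ← at-functional w-at w-at′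

    code-injective : ∀ {c} → Code v c → Code w c → v ≡ w
    code-injective (first v-at) (first w-at) = at-injective v-at w-at
    code-injective (later v-at w-at f) (later v′-at w′-at f′) = fills-functional v-at w-at f v′-at w′-at f′

    n≤paths+slots : n ≤ length ps ℕ.+ length ss
    n≤paths+slots = injective⇒≤ {f = λ w → join _ _ (proj₁ (code w))} λ {v} {w} eq →
      code-injective (proj₂ (code v)) (subst (Code w) (sym (join-injective eq)) (proj₂ (code w)))
      where
      join-injective : ∀ {x y} → join (length ps) (length ss) x ≡ join _ _ y → x ≡ y
      join-injective {x} {y} eq =
        trans (sym (splitAt-join _ _ x)) (trans (cong (splitAt (length ps)) eq) (splitAt-join _ _ y))

  pathCover-bound : ∀ {j} → Peeling (allFin n) k p → ∃[ ps ] (IsPathCover F ps × length ps ≡ j) → n ≤ j ℕ.+ k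
  pathCover-bound d (ps , cover , refl) with peeling-slots d
  ... | ss , refl , fill = n≤paths+slots cover {ss} (fill (∈-allFin _) (∈-allFin _))

-- Triangular submatrices and rank

module Elimination {c ℓ₁ ℓ₂ : Level} (𝔽 : HeytingField c ℓ₁ ℓ₂) where
  open LinearAlgebra 𝔽
  open HeytingField 𝔽 using (_#_; tight; #⇒invertible; invertible⇒#; #-cotrans; heytingCommutativeRing)
  open HeytingCommutativeRing heytingCommutativeRing using (commutativeRing)
  open CommutativeRing commutativeRing hiding (zero)
    renaming (refl to ≈-refl; sym to ≈-sym; trans to ≈-trans)
  open HeytingProperties heytingCommutativeRing
  open RingProperties ring using (-‿distribˡ-*)
  open CommutativeSemigroupProperties +-commutativeSemigroup using (interchange; x∙yz≈y∙xz)
  open SemiringSum semiring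
  open SetoidReasoning setoid

  private
    V : ℕ → Set c
    V = Vector Carrier

    variable
      r s : ℕ
      x y : Carrier

  -- Comparing x + y and 0 with y by cotransitivity takes the place of deciding whether a summand
  -- vanishes: if x + y is apart from y, their difference x is invertible.
  x+y#0⇒x#0∨y#0 : x + y # 0# → x # 0# ⊎ y # 0#
  x+y#0⇒x#0∨y#0 {x} {y} x+y#0 with #-cotrans x+y#0 y
  ... | inj₂ y#0   = inj₂ y#0
  ... | inj₁ x+y#y with #⇒invertible x+y#y
  ...   | e , e*[x+y-y]≈1 , _ = inj₁ (invertibleˡ⇒# (e , ≈-trans (*-congˡ x-0≈x+y-y) e*[x+y-y]≈1))
    where
    x-0≈x+y-y : x - 0# ≈ x + y - y
    x-0≈x+y-y = begin
      x - 0#      ≈⟨ x-0≈x x ⟩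
      x           ≈⟨ +-identityʳ x ⟨
      x + 0#      ≈⟨ +-congˡ (-‿inverseʳ y) ⟨
      x + (y - y) ≈⟨ +-assoc x y (- y) ⟨
      x + y - y   ∎

  x#0⇒leftInvertible : x # 0# → ∃[ e ] e * x ≈ 1#
  x#0⇒leftInvertible {x} x#0 with #⇒invertible x#0
  ... | e , e*[x-0]≈1 , _ = e , ≈-trans (*-congˡ (≈-sym (x-0≈x x))) e*[x-0]≈1

  x*y#0⇒x#0 : x * y # 0# → x # 0#
  x*y#0⇒x#0 {x} {y} xy#0 with x#0⇒leftInvertible xy#0
  ... | e , e*xy≈1 = invertibleʳ⇒# (y * e , (begin
    (x - 0#) * (y * e) ≈⟨ *-congʳ (x-0≈x x) ⟩
    x * (y * e)        ≈⟨ *-assoc x y e ⟨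
    x * y * e          ≈⟨ *-comm (x * y) e ⟩
    e * (x * y)        ≈⟨ e*xy≈1 ⟩
    1#                 ∎))

  ¬#0⇒≈0 : ¬ x # 0# → x ≈ 0#
  ¬#0⇒≈0 {x} = proj₁ (tight x 0#)

  sum-zero : (f : V r) → (∀ j → f j ≈ 0#) → sum f ≈ 0#
  sum-zero {r} f f≈0 = ≈-trans (sum-cong-≋ f≈0) (sum-replicate-zero r)

  -- This supplies the pivot in `exchange`.
  sum#0⇒term#0 : (f : V r) → sum f # 0# → ∃[ j ] f j # 0#
  sum#0⇒term#0 {zero}  f 0#0 = contradiction 0#0 (proj₂ (tight 0# 0#) ≈-refl)
  sum#0⇒term#0 {suc r} f f#0 with x+y#0⇒x#0∨y#0 f#0
  ... | inj₁ f₀#0   = zero , f₀#0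
  ... | inj₂ rest#0 with sum#0⇒term#0 (f ∘ suc) rest#0
  ...   | j , fⱼ#0 = suc j , fⱼ#0

  -- Spans of finite families and the exchange of vectors

  module _ {b : Fin r → V n} where

    inSpan-resp-≈ : ∀ {x y} → (∀ u → y u ≈ x u) → InSpan b x → InSpan b y
    inSpan-resp-≈ y≈x (a , x≈) = a , λ u → ≈-trans (y≈x u) (x≈ u)

    inSpan-0 : InSpan b (λ _ → 0#)
    inSpan-0 = (λ _ → 0#) , λ u → ≈-sym (sum-zero _ λ j → zeroˡ (b j u))

    inSpan-+ : ∀ {x y} → InSpan b x → InSpan b y → InSpan b (λ u → x u + y u)
    inSpan-+ (a , x≈) (a′ , y≈) = (λ j → a j + a′ j) , λ u → begin
      _ + _                                           ≈⟨ +-cong (x≈ u) (y≈ u) ⟩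
      combination a b u + combination a′ b u          ≈⟨ ∑-distrib-+ (λ j → a j * b j u) (λ j → a′ j * b j u) ⟨
      (sum λ j → a j * b j u + a′ j * b j u)          ≈⟨ sum-cong-≋ (λ j → distribʳ (b j u) (a j) (a′ j)) ⟨
      combination (λ j → a j + a′ j) b u              ∎

    inSpan-* : ∀ {x} e → InSpan b x → InSpan b (λ u → e * x u)
    inSpan-* e (a , x≈) = (λ j → e * a j) , λ u → begin
      e * _                              ≈⟨ *-congˡ (x≈ u) ⟩
      e * combination a b u              ≈⟨ *-distribˡ-sum e (λ j → a j * b j u) ⟩
      (sum λ j → e * (a j * b j u))      ≈⟨ sum-cong-≋ (λ j → *-assoc e (a j) (b j u)) ⟨
      combination (λ j → e * a j) b u    ∎

  inSpan-weaken : ∀ (b : Fin (suc r) → V n) {x} → InSpan (b ∘ suc) x → InSpan b x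
  inSpan-weaken b (a , x≈) = (λ { zero → 0# ; (suc j) → a j }) , λ u →
    ≈-trans (x≈ u) (≈-sym (≈-trans (+-congʳ (zeroˡ (b zero u))) (+-identityˡ _)))

  inSpan-generator : (b : Fin r → V n) → ∀ j → InSpan b (b j)
  inSpan-generator b zero = (λ { zero → 1# ; (suc _) → 0# }) , λ u → ≈-sym
    (≈-trans (+-cong (*-identityˡ (b zero u)) (sum-zero _ λ j → zeroˡ (b (suc j) u))) (+-identityʳ _))
  inSpan-generator b (suc j) = inSpan-weaken b (inSpan-generator (b ∘ suc) j)

  inSpan-trans : ∀ {b : Fin r → V n} {d : Fin s → V n} {x} →
    (∀ j → InSpan d (b j)) → InSpan b x → InSpan d x
  inSpan-trans {b = b} {d} b⊆d (a , x≈) = inSpan-resp-≈ x≈ (combination-inSpan a b b⊆d)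
    where
    combination-inSpan : ∀ {r} a (b : Fin r → V _) → (∀ j → InSpan d (b j)) → InSpan d (combination a b)
    combination-inSpan {zero}  a b b⊆d = inSpan-0
    combination-inSpan {suc r} a b b⊆d =
      inSpan-+ (inSpan-* (a zero) (b⊆d zero)) (combination-inSpan (a ∘ suc) (b ∘ suc) (b⊆d ∘ suc))

  -- Membership in the sum of two spans. Keeping the families apart lets a vector of d be traded for
  -- one of b without concatenating index sets.
  record InSpan₂ (b : Fin r → V n) (d : Fin s → V n) (x : V n) : Set (c ⊔ ℓ₁) where
    constructor split
    field
      {xᵇ xᵈ} : V n
      xᵇ∈     : InSpan b xᵇ
      xᵈ∈     : InSpan d xᵈ
      is-sum  : ∀ u → x u ≈ xᵇ u + xᵈ u

  module _ {b : Fin r → V n} {d : Fin s → V n} where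

    inSpan₂-resp-≈ : ∀ {x y} → (∀ u → y u ≈ x u) → InSpan₂ b d x → InSpan₂ b d y
    inSpan₂-resp-≈ y≈x (split p q x≈) = split p q λ u → ≈-trans (y≈x u) (x≈ u)

    inSpan₂-+ : ∀ {x y} → InSpan₂ b d x → InSpan₂ b d y → InSpan₂ b d (λ u → x u + y u)
    inSpan₂-+ (split p q x≈) (split p′ q′ y≈) =
      split (inSpan-+ p p′) (inSpan-+ q q′) λ u → ≈-trans (+-cong (x≈ u) (y≈ u)) (interchange _ _ _ _)

    inSpan₂-* : ∀ {x} e → InSpan₂ b d x → InSpan₂ b d (λ u → e * x u)
    inSpan₂-* e (split p q x≈) =
      split (inSpan-* e p) (inSpan-* e q) λ u → ≈-trans (*-congˡ (x≈ u)) (distribˡ e _ _)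

    inSpan₂ˡ : ∀ {x} → InSpan b x → InSpan₂ b d x
    inSpan₂ˡ p = split p inSpan-0 λ u → ≈-sym (+-identityʳ _)

    inSpan₂ʳ : ∀ {x} → InSpan d x → InSpan₂ b d x
    inSpan₂ʳ q = split inSpan-0 q λ u → ≈-sym (+-identityˡ _)

  combination-remove : ∀ a (b : Fin (suc r) → V n) i u →
    combination a b u ≈ a i * b i u + combination (removeAt a i) (removeAt b i) u
  combination-remove a b i u = sum-remove (λ j → a j * b j u)

  vanishing-inSpan : ∀ (b : Fin r → V n) {x u} → (∀ j → b j u ≈ 0#) → InSpan b x → x u ≈ 0#
  vanishing-inSpan b {u = u} b≈0 (a , x≈) =
    ≈-trans (x≈ u) (sum-zero _ λ j → ≈-trans (*-congˡ (b≈0 j)) (zeroʳ (a j)))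

  -- In `exchange`, x is an entry of `b zero`, y the same entry of the vector `d j` to be replaced,
  -- a its coefficient and e the inverse of a.
  solve-for : ∀ {e a x c y t} → e * a ≈ 1# → x ≈ c + (a * y + t) → y ≈ e * x + (- e) * (c + t)
  solve-for {e} {a} {x} {c} {y} {t} ea≈1 x≈ = ≈-sym (begin
    e * x + (- e) * (c + t)                   ≈⟨ +-congʳ (*-congˡ (≈-trans x≈ (x∙yz≈y∙xz c (a * y) t))) ⟩
    e * (a * y + (c + t)) + (- e) * (c + t)   ≈⟨ +-cong (distribˡ e (a * y) (c + t)) (≈-sym (-‿distribˡ-* e (c + t))) ⟩
    e * (a * y) + e * (c + t) - e * (c + t)   ≈⟨ +-assoc _ _ _ ⟩
    e * (a * y) + (e * (c + t) - e * (c + t)) ≈⟨ +-cong (≈-sym (*-assoc e a y)) (-‿inverseʳ _) ⟩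
    e * a * y + 0#                            ≈⟨ +-identityʳ _ ⟩
    e * a * y                                 ≈⟨ *-congʳ ea≈1 ⟩
    1# * y                                    ≈⟨ *-identityˡ y ⟩
    y                                         ∎)

  -- Steinitz exchange. The later vectors of b vanish at u, so the entry of `b zero` at u comes from
  -- d alone. Some term of that combination is apart from 0, its coefficient is invertible, and the
  -- corresponding vector of d is replaced by `b zero`. In particular d cannot be empty.
  exchange : (b : Fin (suc s) → V n) (d : Fin r → V n) (u : Fin n) →
    b zero u # 0# → (∀ j → b (suc j) u ≈ 0#) → InSpan₂ (b ∘ suc) d (b zero) →
    ∃[ r′ ] (r ≡ suc r′ × ∃ λ (d′ : Fin r′ → V n) → ∀ {x} → InSpan₂ (b ∘ suc) d x → InSpan₂ b d′ x)
  exchange {r = zero} b d u b₀#0 b≈0 (split p (_ , z≈) b₀≈) = contradiction b₀#0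
    (proj₂ (tight _ _) (≈-trans (b₀≈ u) (≈-trans (+-cong (vanishing-inSpan (b ∘ suc) b≈0 p) (z≈ u)) (+-identityˡ 0#))))
  exchange {s} {n} {suc r} b d u b₀#0 b≈0 (split p (a , z≈) b₀≈)
    with sum#0⇒term#0 (λ j → a j * d j u)
           (#-congʳ (≈-trans (b₀≈ u) (≈-trans (+-cong (vanishing-inSpan (b ∘ suc) b≈0 p) (z≈ u)) (+-identityˡ _))) b₀#0)
  ... | j , aⱼdⱼ#0 with x#0⇒leftInvertible (x*y#0⇒x#0 aⱼdⱼ#0)
  ...   | e , e*aⱼ≈1 = r , refl , d′ , replace
    where
    d′ : Fin r → V n
    d′ = removeAt d j

    rest : ∀ a → InSpan₂ b d′ (combination (removeAt a j) d′)
    rest a = inSpan₂ʳ (removeAt a j , λ _ → ≈-refl)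

    dⱼ∈ : InSpan₂ b d′ (d j)
    dⱼ∈ = inSpan₂-resp-≈
      (λ v → solve-for e*aⱼ≈1 (≈-trans (b₀≈ v) (+-congˡ (≈-trans (z≈ v) (combination-remove a d j v)))))
      (inSpan₂-+ (inSpan₂-* e (inSpan₂ˡ (inSpan-generator b zero)))
        (inSpan₂-* (- e) (inSpan₂-+ (inSpan₂ˡ (inSpan-weaken b p)) (rest a))))

    replace : ∀ {x} → InSpan₂ (b ∘ suc) d x → InSpan₂ b d′ x
    replace (split p (a , z≈) x≈) = inSpan₂-resp-≈
      (λ v → ≈-trans (x≈ v) (+-congˡ (≈-trans (z≈ v) (combination-remove a d j v))))
      (inSpan₂-+ (inSpan₂ˡ (inSpan-weaken b p)) (inSpan₂-+ (inSpan₂-* (a j) dⱼ∈) (rest a)))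

  module _ (M : SquareMatrix n) where

    Position : Set
    Position = Fin n × Fin n

    record Triangular (fs : List Position) : Set (ℓ₁ ⊔ ℓ₂) where
      constructor triangular
      field
        diagonal : All (λ (v , w) → M v w # 0#) fs
        zeros    : AllPairs (λ (v , _) (_ , w) → M v w ≈ 0#) fs

    selected : (fs : List Position) → Fin (length fs) → V n
    selected fs i = columns M (proj₂ (lookup fs i))

    -- The selected columns are exchanged into d from the last to the first. Row v of the head
    -- position vanishes in all later selected columns, so v serves as the coordinate u of
    -- `exchange`.
    exchange-columns : ∀ {fs} → Triangular fs → (d : Fin r → V n) → (∀ v → InSpan d (columns M v)) →
      ∃[ r′ ] (length fs ℕ.+ r′ ≡ r × ∃ λ (d′ : Fin r′ → V n) → ∀ v → InSpan₂ (selected fs) d′ (columns M v))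
    exchange-columns {fs = []} _ d cols = _ , refl , d , λ v → inSpan₂ʳ (cols v)
    exchange-columns {fs = (v , w) ∷ fs} (triangular (vw#0 ∷ diag) (v0 ∷ zeros)) d cols
      with exchange-columns {fs = fs} (triangular diag zeros) d cols
    ... | r₁ , eq , d₁ , cols₁
      with exchange (selected ((v , w) ∷ fs)) d₁ v vw#0 (λ j → All.lookup v0 (∈-lookup j)) (cols₁ w)
    ...   | r₂ , refl , d₂ , replace = r₂ , trans (sym (ℕ.+-suc (length fs) r₂)) eq , d₂ , λ v → replace (cols₁ v)

    triangular-length : ∀ {fs} → Triangular fs → (d : Fin r → V n) → (∀ v → InSpan d (columns M v)) → length fs ℕ.≤ r
    triangular-length {fs = fs} t d cols with exchange-columns t d cols
    ... | r′ , refl , _ = ℕ.m≤m+n (length fs) r′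

    triangular-rank : ∀ {fs r} → Triangular fs → HasRank M r → length fs ℕ.≤ r
    triangular-rank t (b , basis) = triangular-length t b λ v →
      IsColumnSpaceBasis.spans basis (columns M v) (inSpan-generator (columns M) v)

    -- Row v of the first position sees only the first selected column, which makes the first
    -- coefficient vanish; the others follow by recursion.
    selected-independent : ∀ {fs} → Triangular fs → LinearlyIndependent (selected fs)
    selected-independent {(v , w) ∷ fs} (triangular (vw#0 ∷ diag) (v0 ∷ zeros)) a comb≈0 =
      λ { zero → a₀≈0 ; (suc j) → selected-independent {fs} (triangular diag zeros) (a ∘ suc) comb′≈0 j }
      where
      aM≈0 : a zero * M v w ≈ 0#
      aM≈0 = ≈-trans (≈-sym (≈-trans (+-congˡ (sum-zero _ λ j →
        ≈-trans (*-congˡ (All.lookup v0 (∈-lookup j))) (zeroʳ (a (suc j))))) (+-identityʳ _))) (comb≈0 v)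

      a₀≈0 : a zero ≈ 0#
      a₀≈0 with x#0⇒leftInvertible vw#0
      ... | e , e*M≈1 = begin
        a zero               ≈⟨ *-identityʳ _ ⟨
        a zero * 1#          ≈⟨ *-congˡ (≈-trans (*-comm (M v w) e) e*M≈1) ⟨
        a zero * (M v w * e) ≈⟨ *-assoc _ _ _ ⟨
        a zero * M v w * e   ≈⟨ *-congʳ aM≈0 ⟩
        0# * e               ≈⟨ zeroˡ e ⟩
        0#                   ∎

      comb′≈0 : ∀ u → combination (a ∘ suc) (selected fs) u ≈ 0#
      comb′≈0 u = ≈-trans (≈-sym (≈-trans (+-congʳ (≈-trans (*-congʳ a₀≈0) (zeroˡ _))) (+-identityˡ _))) (comb≈0 u)

    -- As d has exactly as many vectors as there are positions, the exchange uses up all of d, and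
    -- the selected columns span alone.
    triangular⇒hasRank : ∀ {fs} → Triangular fs → (d : Fin (length fs) → V n) →
      (∀ v → InSpan d (columns M v)) → HasRank M (length fs)
    triangular⇒hasRank {fs} t d cols = selected fs , record
      { inColumnSpace = λ j → inSpan-generator (columns M) (proj₂ (lookup fs j))
      ; independent   = selected-independent t
      ; spans         = λ x → inSpan-trans spanned
      }
      where
      spanned : ∀ v → InSpan (selected fs) (columns M v)
      spanned v with exchange-columns t d cols
      ... | suc r′ , eq , _ = contradiction (trans (sym (ℕ.+-suc _ r′)) eq) (ℕ.m≢1+m+n _ ∘ sym)
      ... | zero , _ , d′ , cols′ with cols′ v
      ...   | split p (_ , z≈0) x≈ = inSpan-resp-≈ (λ u → ≈-trans (x≈ u) (≈-trans (+-congˡ (z≈0 u)) (+-identityʳ _))) p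

-- Signed sums of cliques

subset : {P : Pred (Fin n) 0ℓ} → Decidable P → Subset n
subset P? = Vec.tabulate (does ∘ P?)

module _ {P : Pred (Fin n) 0ℓ} (P? : Decidable P) where

  lookup-subset⁺ : ∀ {x} → P x → Vec.lookup (subset P?) x ≡ true
  lookup-subset⁺ {x} px = trans (lookup∘tabulate (does ∘ P?) x) (dec-true (P? x) px)

  lookup-subset⁻ : ∀ {x} → ¬ P x → Vec.lookup (subset P?) x ≡ false
  lookup-subset⁻ {x} ¬px = trans (lookup∘tabulate (does ∘ P?) x) (dec-false (P? x) ¬px)

module Gram {c ℓ₁ ℓ₂ : Level} (𝔽 : HeytingField c ℓ₁ ℓ₂) (F : Graph n) where
  open LinearAlgebra 𝔽
  open HeytingField 𝔽 using (_#_; tight; heytingCommutativeRing)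
  open HeytingCommutativeRing heytingCommutativeRing using (commutativeRing)
  open CommutativeRing commutativeRing hiding (zero)
    renaming (refl to ≈-refl; sym to ≈-sym; trans to ≈-trans)
  open HeytingProperties heytingCommutativeRing
  open CommutativeSemigroupProperties *-commutativeSemigroup using (xy∙z≈xz∙y)
  open SemiringSum semiring
  open Elimination 𝔽
  open Peelings F
  open Chains F
  open DecMembership (_≟_ {n}) using (_∈?_)

  private
    V : Set
    V = Fin n

    variable
      A : List V

  SignedSets : Set
  SignedSets = List (Sign × Subset n)

  bit : Bool → Carrier
  bit b = if b then 1# else 0#

  sgn : Sign → Carrier
  sgn Sign.+ = 1#
  sgn Sign.- = - 1#

  -- The sign sits on the column factor, so that the columns of `gram` are combinations of the plain
  -- indicator vectors.
  weight : Sign × Subset n → V → Carrier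
  weight (s , S) y = sgn s * bit (Vec.lookup S y)

  indicator : Sign × Subset n → V → Carrier
  indicator (_ , S) x = bit (Vec.lookup S x)

  -- ∑ ± 1ₛ 1ₛᵀ over the signed sets S.
  gram : SignedSets → SquareMatrix n
  gram L x y = combination (λ j → weight (lookup L j) y) (λ j → indicator (lookup L j)) x

  gram-symmetric : ∀ L x y → gram L x y ≈ gram L y x
  gram-symmetric L x y = sum-cong-≋ λ j →
    xy∙z≈xz∙y (sgn (proj₁ (lookup L j))) (indicator (lookup L j) y) (indicator (lookup L j) x)

  gram-columns : ∀ L y → InSpan (λ j → indicator (lookup L j)) (columns (gram L) y)
  gram-columns L y = (λ j → weight (lookup L j) y) , λ x → ≈-refl

  -- Since 1 is apart from 0 in every field, indicating adjacency yields a fitting matrix over any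
  -- field, and over 𝔽₂ it is a statement about parities.
  Indicates : Set → Carrier → Set ℓ₁
  Indicates P t = (P → t ≈ 1#) × (¬ P → t ≈ 0#)

  -- Disjointness excludes 1 + 1, which is neither 0 nor 1 in general.
  indicates-⊎ : ∀ {P Q R t t′} → Dec P → (P → ¬ Q) → (R → P ⊎ Q) → (P ⊎ Q → R) →
    Indicates P t → Indicates Q t′ → Indicates R (t + t′)
  indicates-⊎ (yes p) disj to from (t≈1 , _) (_ , t′≈0) =
    (λ _ → ≈-trans (+-cong (t≈1 p) (t′≈0 (disj p))) (+-identityʳ 1#)) , λ ¬r → contradiction (from (inj₁ p)) ¬r
  indicates-⊎ {Q = Q} (no ¬p) disj to from (_ , t≈0) (t′≈1 , t′≈0) =
    (λ r → ≈-trans (+-cong (t≈0 ¬p) (t′≈1 ([ (λ p → contradiction p ¬p) , (λ q → q) ]′ (to r)))) (+-identityˡ 1#)) ,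
    λ ¬r → ≈-trans (+-cong (t≈0 ¬p) (t′≈0 (¬r ∘ from ∘ inj₂))) (+-identityˡ 0#)

  term : Sign × Subset n → SquareMatrix n
  term S x y = weight S y * indicator S x

  module _ {P : Pred V 0ℓ} (P? : Decidable P) (s : Sign) {x y : V} where

    term-inside : P x → P y → term (s , subset P?) x y ≈ sgn s
    term-inside px py rewrite lookup-subset⁺ P? px | lookup-subset⁺ P? py =
      ≈-trans (*-identityʳ _) (*-identityʳ _)

    term-outsideˡ : ¬ P x → term (s , subset P?) x y ≈ 0#
    term-outsideˡ ¬px rewrite lookup-subset⁻ P? ¬px = zeroʳ _

    term-outsideʳ : ¬ P y → term (s , subset P?) x y ≈ 0#
    term-outsideʳ ¬py rewrite lookup-subset⁻ P? ¬py = ≈-trans (*-congʳ (zeroʳ _)) (zeroˡ _)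

  Edge : List V → V → V → Set
  Edge A x y = x ∈ A × y ∈ A × Adj x y

  Represents : SignedSets → List V → Set ℓ₁
  Represents L A = ∀ {x y} → x ≢ y → Indicates (Edge A x y) (gram L x y)

  module EdgeTerm (u v : V) where

    IsPair : V → V → Set
    IsPair x y = (x ≡ u × y ≡ v) ⊎ (x ≡ v × y ≡ u)

    isPair? : ∀ x y → Dec (IsPair x y)
    isPair? x y = ((x ≟ u) ×-dec (y ≟ v)) ⊎-dec ((x ≟ v) ×-dec (y ≟ u))

    isEnd? : Decidable (λ w → w ≡ u ⊎ w ≡ v)
    isEnd? w = (w ≟ u) ⊎-dec (w ≟ v)

    edge : Sign × Subset n
    edge = Sign.+ , subset isEnd?

    edge-term : ∀ {x y} → x ≢ y → Indicates (IsPair x y) (term edge x y)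
    edge-term {x} {y} x≢y = ends , λ ¬pair → not-ends ¬pair (isEnd? x) (isEnd? y)
      where
      ends : IsPair x y → term edge x y ≈ 1#
      ends (inj₁ (x≡u , y≡v)) = term-inside isEnd? Sign.+ (inj₁ x≡u) (inj₂ y≡v)
      ends (inj₂ (x≡v , y≡u)) = term-inside isEnd? Sign.+ (inj₂ x≡v) (inj₁ y≡u)

      not-ends : ¬ IsPair x y → Dec (x ≡ u ⊎ x ≡ v) → Dec (y ≡ u ⊎ y ≡ v) → term edge x y ≈ 0#
      not-ends _ (no x∉) _ = term-outsideˡ isEnd? Sign.+ x∉
      not-ends _ _ (no y∉) = term-outsideʳ isEnd? Sign.+ y∉
      not-ends _ (yes (inj₁ refl)) (yes (inj₁ refl)) = contradiction refl x≢y
      not-ends _ (yes (inj₂ refl)) (yes (inj₂ refl)) = contradiction refl x≢y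
      not-ends ¬pair (yes (inj₁ x≡u)) (yes (inj₂ y≡v)) = contradiction (inj₁ (x≡u , y≡v)) ¬pair
      not-ends ¬pair (yes (inj₂ x≡v)) (yes (inj₁ y≡u)) = contradiction (inj₂ (x≡v , y≡u)) ¬pair

  -- The star with centre u and leaves N is the difference of the cliques on u ∷ N and N.
  module StarTerm (u : V) {N : Pred V 0ℓ} (N? : Decidable N) (u∉N : ¬ N u) where

    IsRay : V → V → Set
    IsRay x y = (x ≡ u × N y) ⊎ (y ≡ u × N x)

    isRay? : ∀ x y → Dec (IsRay x y)
    isRay? x y = ((x ≟ u) ×-dec N? y) ⊎-dec ((y ≟ u) ×-dec N? x)

    closed? : Decidable (λ w → w ≡ u ⊎ N w)
    closed? w = (w ≟ u) ⊎-dec N? w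

    outer inner : Sign × Subset n
    outer = Sign.+ , subset closed?
    inner = Sign.- , subset N?

    -- Pairs inside N lie in both cliques and cancel; pairs of u with a vertex of N lie in the outer
    -- one only.
    star-term : ∀ {x y} → x ≢ y → Indicates (IsRay x y) (term outer x y + term inner x y)
    star-term {x} {y} x≢y = rays , λ ¬ray → non-rays ¬ray (closed? x) (closed? y)
      where
      rays : IsRay x y → term outer x y + term inner x y ≈ 1#
      rays (inj₁ (refl , y∈N)) = ≈-trans
        (+-cong (term-inside closed? Sign.+ (inj₁ refl) (inj₂ y∈N)) (term-outsideˡ N? Sign.- u∉N)) (+-identityʳ 1#)
      rays (inj₂ (refl , x∈N)) = ≈-trans
        (+-cong (term-inside closed? Sign.+ (inj₂ x∈N) (inj₁ refl)) (term-outsideʳ N? Sign.- u∉N)) (+-identityʳ 1#)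

      non-rays : ¬ IsRay x y → Dec (x ≡ u ⊎ N x) → Dec (y ≡ u ⊎ N y) → term outer x y + term inner x y ≈ 0#
      non-rays _ (no x∉) _ = ≈-trans
        (+-cong (term-outsideˡ closed? Sign.+ x∉) (term-outsideˡ N? Sign.- (x∉ ∘ inj₂))) (+-identityʳ 0#)
      non-rays _ _ (no y∉) = ≈-trans
        (+-cong (term-outsideʳ closed? Sign.+ y∉) (term-outsideʳ N? Sign.- (y∉ ∘ inj₂))) (+-identityʳ 0#)
      non-rays _ (yes (inj₁ refl)) (yes (inj₁ refl)) = contradiction refl x≢y
      non-rays ¬ray (yes (inj₁ x≡u)) (yes (inj₂ y∈N)) = contradiction (inj₁ (x≡u , y∈N)) ¬ray
      non-rays ¬ray (yes (inj₂ x∈N)) (yes (inj₁ y≡u)) = contradiction (inj₂ (y≡u , x∈N)) ¬ray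
      non-rays _ (yes (inj₂ x∈N)) (yes (inj₂ y∈N)) = ≈-trans
        (+-cong (term-inside closed? Sign.+ (inj₂ x∈N) (inj₂ y∈N)) (term-inside N? Sign.- x∈N y∈N)) (-‿inverseʳ 1#)

  indicates-⇔ : ∀ {P Q t} → (P → Q) → (Q → P) → Indicates P t → Indicates Q t
  indicates-⇔ to from (t≈1 , t≈0) = t≈1 ∘ from , λ ¬q → t≈0 (¬q ∘ to)

  indicates-resp-≈ : ∀ {P t t′} → t′ ≈ t → Indicates P t → Indicates P t′
  indicates-resp-≈ t′≈t (t≈1 , t≈0) = ≈-trans t′≈t ∘ t≈1 , ≈-trans t′≈t ∘ t≈0

  edge-map : ∀ {B} → (∀ {x} → x ∈ A → x ∈ B) → ∀ {x y} → Edge A x y → Edge B x y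
  edge-map A⊆B (x∈ , y∈ , xy) = A⊆B x∈ , A⊆B y∈ , xy

  peeling-signedSets : Peeling A k p → ∃[ L ] (length L ≡ k × Represents L A)
  peeling-signedSets empty = [] , refl , λ _ → (λ ()) , λ _ → ≈-refl
  peeling-signedSets {v ∷ A} (isolated v∉A alone d) with peeling-signedSets d
  ... | L , len , rep = L , len , λ x≢y → indicates-⇔ (edge-map there) old (rep x≢y)
    where
    old : ∀ {x y} → Edge (v ∷ A) x y → Edge A x y
    old (here refl , here refl , xy) = contradiction xy (irrefl refl)
    old (here refl , there y∈ , xy) = contradiction xy (alone y∈)
    old (there x∈ , here refl , xy) = contradiction (adj-sym xy) (alone x∈)
    old (there x∈ , there y∈ , xy) = x∈ , y∈ , xy
  peeling-signedSets {v ∷ A} (leaf {u = u} v∉A u∈A uv only-v _ d) with peeling-signedSets d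
  ... | L , len , rep = edge ∷ L , cong suc len , λ {x} {y} x≢y →
      indicates-⊎ (isPair? x y) disjoint to from (edge-term x≢y) (rep x≢y)
    where
    open EdgeTerm u v
    disjoint : ∀ {x y} → IsPair x y → ¬ Edge A x y
    disjoint (inj₁ (_ , refl)) (_ , v∈A , _) = v∉A v∈A
    disjoint (inj₂ (refl , _)) (v∈A , _ , _) = v∉A v∈A
    to : ∀ {x y} → Edge (v ∷ A) x y → IsPair x y ⊎ Edge A x y
    to (here refl , here refl , xy) = contradiction xy (irrefl refl)
    to (here x≡v , there y∈ , xy) = inj₁ (inj₂ (x≡v , only-v y∈ (subst (λ z → Adj z _) x≡v xy)))
    to (there x∈ , here y≡v , xy) = inj₁ (inj₁ (only-v x∈ (subst (λ z → Adj z _) y≡v (adj-sym xy)) , y≡v))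
    to (there x∈ , there y∈ , xy) = inj₂ (x∈ , y∈ , xy)
    from : ∀ {x y} → IsPair x y ⊎ Edge A x y → Edge (v ∷ A) x y
    from (inj₁ (inj₁ (refl , refl))) = there u∈A , here refl , uv
    from (inj₁ (inj₂ (refl , refl))) = here refl , there u∈A , adj-sym uv
    from (inj₂ e) = edge-map there e
  peeling-signedSets {A′@(a ∷ u ∷ b ∷ A)} (cherry (_ ∷ (_ ∷ u≢A) ∷ _) _ _ only-a only-b d) with peeling-signedSets d
  ... | L , len , rep = outer ∷ inner ∷ L , cong (2 ℕ.+_) len , λ {x} {y} x≢y →
      indicates-resp-≈ (≈-sym (+-assoc _ _ _))
        (indicates-⊎ (isRay? x y) disjoint to from (star-term x≢y) (rep x≢y))
    where
    -- The star takes in every neighbour of u in A′, not just a and b, because u is removed with all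
    -- its edges.
    open StarTerm u (λ w → (w ∈? A′) ×-dec adj? u w) (λ (_ , uu) → irrefl refl uu)
    u∉A : u ∉ A
    u∉A u∈A = All.lookup u≢A u∈A refl
    disjoint : ∀ {x y} → IsRay x y → ¬ Edge A x y
    disjoint (inj₁ (refl , _)) (u∈A , _ , _) = u∉A u∈A
    disjoint (inj₂ (refl , _)) (_ , u∈A , _) = u∉A u∈A
    from : ∀ {x y} → IsRay x y ⊎ Edge A x y → Edge A′ x y
    from (inj₁ (inj₁ (refl , y∈ , uy))) = there (here refl) , y∈ , uy
    from (inj₁ (inj₂ (refl , x∈ , ux))) = x∈ , there (here refl) , adj-sym ux
    from (inj₂ e) = edge-map (there ∘ there ∘ there) e
    fromCentre : ∀ {x y} → x ≡ u → Edge A′ x y → IsRay x y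
    fromCentre refl (_ , y∈ , uy) = inj₁ (refl , y∈ , uy)
    toCentre : ∀ {x y} → y ≡ u → Edge A′ x y → IsRay x y
    toCentre refl (x∈ , _ , xu) = inj₂ (refl , x∈ , adj-sym xu)
    to : ∀ {x y} → Edge A′ x y → IsRay x y ⊎ Edge A x y
    to e@(here refl , y∈ , xy) = inj₁ (toCentre (only-a y∈ xy) e)
    to e@(there (here x≡u) , _ , _) = inj₁ (fromCentre x≡u e)
    to e@(there (there (here refl)) , y∈ , xy) = inj₁ (toCentre (only-b y∈ xy) e)
    to e@(x∈ , here refl , xy) = inj₁ (fromCentre (only-a x∈ (adj-sym xy)) e)
    to e@(_ , there (here y≡u) , _) = inj₁ (toCentre y≡u e)
    to e@(x∈ , there (there (here refl)) , xy) = inj₁ (fromCentre (only-b x∈ (adj-sym xy)) e)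
    to (there (there (there x∈)) , there (there (there y∈)) , xy) = inj₂ (x∈ , y∈ , xy)
  peeling-signedSets (reorder π d) with peeling-signedSets d
  ... | L , len , rep = L , len , λ x≢y →
    indicates-⇔ (edge-map (∈-resp-↭ π)) (edge-map (∈-resp-↭ (↭-sym π))) (rep x≢y)

  represents⇒adj : ∀ {L} → Represents L (allFin n) → ∀ {u v} → u ≢ v → Indicates (Adj u v) (gram L u v)
  represents⇒adj rep u≢v = indicates-⇔ (proj₂ ∘ proj₂) (λ uv → ∈-allFin _ , ∈-allFin _ , uv) (rep u≢v)

  indicates⇒#0 : ∀ {P t} → Dec P → Indicates P t → t # 0# ⇔ P
  indicates⇒#0 (yes p) (t≈1 , _) = mk⇔ (λ _ → p) λ _ → #-congʳ (≈-sym (t≈1 p)) 1#0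
  indicates⇒#0 (no ¬p) (_ , t≈0) = mk⇔ (λ t#0 → contradiction t#0 (proj₂ (tight _ _) (t≈0 ¬p))) λ p → contradiction p ¬p

  gram-fits : ∀ {L} → (∀ {u v} → u ≢ v → Indicates (Adj u v) (gram L u v)) → Fits F (gram L)
  gram-fits {L} ind = record
    { symmetric = gram-symmetric L
    ; pattern-⇔ = λ u v u≢v → indicates⇒#0 (adj? u v) (ind u≢v)
    }

  chain⇒triangular : ∀ {M fs} → Fits F M → Chain fs → Triangular M fs
  chain⇒triangular fits (chain adjs ord) = triangular
    (All.map (λ vw → Equivalence.from (pattern-⇔ _ _ (adj⇒≢ vw)) vw) adjs)
    (AllPairs.map (λ (v≢w , ¬vw) → ¬#0⇒≈0 (¬vw ∘ Equivalence.to (pattern-⇔ _ _ v≢w))) ord)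
    where open Fits fits

  -- The chain is triangular in every fitting matrix and bounds its rank from below. In `gram L` it
  -- meets k spanning indicators, so the rank is exactly k.
  minimumRank : Peeling (allFin n) k p → IsMinimumRank F k
  minimumRank d with peeling-chain d | peeling-signedSets d
  ... | fs , ch , _ , refl | L , len , rep =
    (gram L , gram-fits {L} (represents⇒adj {L} rep) , rank) ,
    λ { _ (M , fits , hasRank) → triangular-rank M (chain⇒triangular fits ch) hasRank }
    where
    t : Triangular (gram L) fs
    t = chain⇒triangular (gram-fits {L} (represents⇒adj {L} rep)) ch

    rank : HasRank (gram L) (length fs)
    -- The indicators are indexed by `length L`, which `len` identifies with the number of forces.
    rank = subst (λ r → {d : Fin r → _} → (∀ v → InSpan d (columns (gram L) v)) → HasRank (gram L) (length fs))
      (sym len) (λ {d} → triangular⇒hasRank (gram L) t d) (gram-columns L)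

  -- Such a `gram L` is itself a fitting matrix, with columns spanned by `length L` vectors, so the
  -- k forces cannot outnumber the signed sets.
  signedSets-bound : ∀ {L} → Peeling (allFin n) k p →
    (∀ {u v} → u ≢ v → Indicates (Adj u v) (gram L u v)) → k ℕ.≤ length L
  signedSets-bound {L = L} d ind with peeling-chain d
  ... | fs , ch , _ , refl = triangular-length (gram L) (chain⇒triangular (gram-fits {L} ind) ch) _ (gram-columns L)

-- Complementation systems

𝔽₂ : HeytingField 0ℓ 0ℓ 0ℓ
𝔽₂ = record
  { Carrier = Bool
  ; _≈_ = _≡_
  ; _#_ = _≢_
  ; _+_ = _xor_
  ; _*_ = _∧_
  ; -_  = λ x → x
  ; 0#  = false
  ; 1#  = true
  ; isHeytingField = record
    { isHeytingCommutativeRing = record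
      { isCommutativeRing = CommutativeRing.isCommutativeRing xor-∧-commutativeRing
      ; isApartnessRelation = record
        { irrefl = λ x≡y x≢y → x≢y x≡y
        ; sym = ≢-sym
        ; cotrans = λ {x} x≢y z → cotrans x≢y (x ≟ᵇ z)
        }
      -- Distinct bits differ by 1, which is its own inverse.
      ; #⇒invertible = λ x≢y → true , xor-≢ x≢y , cong (_∧ true) (xor-≢ x≢y)
      ; invertible⇒# = λ { {x} (e , eq , _) refl → xor-≡ x e eq }
      }
    ; tight = λ x y → decidable-stable (x ≟ᵇ y) , λ x≡y x≢y → x≢y x≡y
    }
  }
  where
  cotrans : ∀ {x y z : Bool} → x ≢ y → Dec (x ≡ z) → x ≢ z ⊎ z ≢ y
  cotrans x≢y (yes refl) = inj₂ x≢y
  cotrans x≢y (no x≢z)     = inj₁ x≢z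
  xor-≢ : ∀ {x y} → x ≢ y → x xor y ≡ true
  xor-≢ {false} {false} x≢y = contradiction refl x≢y
  xor-≢ {false} {true}  x≢y = refl
  xor-≢ {true}  {false} x≢y = refl
  xor-≢ {true}  {true}  x≢y = contradiction refl x≢y
  xor-≡ : ∀ x e → ¬ e ∧ (x xor x) ≡ true
  xor-≡ false false ()
  xor-≡ false true  ()
  xor-≡ true  false ()
  xor-≡ true  true  ()

odd : ℕ → Bool
odd zero    = false
odd (suc m) = not (odd m)

odd⇔%2≡1 : ∀ m → odd m ≡ true ⇔ m % 2 ≡ 1
odd⇔%2≡1 zero = mk⇔ (λ ()) (λ ())
odd⇔%2≡1 (suc zero) = mk⇔ (λ _ → refl) (λ _ → refl)
odd⇔%2≡1 (suc (suc m)) with odd m | odd⇔%2≡1 m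
... | true  | e = e
... | false | e = e

does-∈? : ∀ x (S : Subset n) → does (x ∈ₛ? S) ≡ Vec.lookup S x
does-∈? zero    (inside  Vec.∷ S) = refl
does-∈? zero    (outside Vec.∷ S) = refl
does-∈? (suc x) (_       Vec.∷ S) = does-∈? x S

module Complementation (F : Graph n) where
  open Gram 𝔽₂ F
  open Peelings F

  -- Over 𝔽₂ both signs are 1, so each set contributes 1 exactly when it contains u and v, and
  -- adding bits counts these sets modulo 2.
  gram-parity : ∀ L u v → gram L u v ≡ odd (jointCount (map proj₂ L) u v)
  gram-parity [] u v = refl
  gram-parity ((s , S) ∷ L) u v rewrite does-∈? u S | does-∈? v S with s | Vec.lookup S u | Vec.lookup S v
  ... | Sign.+ | true  | true  = cong not (gram-parity L u v)
  ... | Sign.- | true  | true  = cong not (gram-parity L u v)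
  ... | Sign.+ | true  | false = gram-parity L u v
  ... | Sign.- | true  | false = gram-parity L u v
  ... | Sign.+ | false | true  = gram-parity L u v
  ... | Sign.- | false | true  = gram-parity L u v
  ... | Sign.+ | false | false = gram-parity L u v
  ... | Sign.- | false | false = gram-parity L u v

  gram≡1⇔odd : ∀ L u v → gram L u v ≡ true ⇔ jointCount (map proj₂ L) u v % 2 ≡ 1
  gram≡1⇔odd L u v rewrite gram-parity L u v = odd⇔%2≡1 (jointCount (map proj₂ L) u v)

  complementationNumber : Peeling (allFin n) k p → IsComplementationNumber F k
  complementationNumber {k = k} d = attained (peeling-signedSets d) , λ { _ (𝒞 , system , refl) → bound 𝒞 system }
    where
    attained : ∃[ L ] (length L ≡ k × Represents L (allFin n)) → ∃[ 𝒞 ] (IsComplementationSystem F 𝒞 × length 𝒞 ≡ k)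
    attained (L , len , rep) = map proj₂ L , system , trans (length-map proj₂ L) len
      where
      system : IsComplementationSystem F (map proj₂ L)
      system u v u≢v with represents⇒adj {L} rep u≢v
      ... | adj⇒1 , ¬adj⇒0 = mk⇔ (Equivalence.to (gram≡1⇔odd L u v) ∘ adj⇒1) back
        where
        back : jointCount (map proj₂ L) u v % 2 ≡ 1 → Adj u v
        back odd = decidable-stable (adj? u v) λ ¬uv →
          contradiction (trans (sym (Equivalence.from (gram≡1⇔odd L u v) odd)) (¬adj⇒0 ¬uv)) λ ()

    -- An arbitrary system becomes a signed one by giving every set the sign +; its `gram` over 𝔽₂
    -- then indicates adjacency.
    bound : ∀ 𝒞 → IsComplementationSystem F 𝒞 → k ℕ.≤ length 𝒞
    bound 𝒞 system = subst (k ℕ.≤_) (length-map positive 𝒞) (signedSets-bound {L = L} d λ u≢v → indicates u≢v)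
      where
      positive : Subset n → Sign × Subset n
      positive S = Sign.+ , S

      L : SignedSets
      L = map positive 𝒞

      sets-L : map proj₂ L ≡ 𝒞
      sets-L = trans (sym (map-∘ 𝒞)) (map-id 𝒞)

      odd⇔adj : ∀ {u v} → u ≢ v → Adj u v ⇔ gram L u v ≡ true
      odd⇔adj {u} {v} u≢v with gram≡1⇔odd L u v
      ... | e rewrite sets-L = mk⇔ (Equivalence.from e ∘ Equivalence.to (system u v u≢v))
                                   (Equivalence.from (system u v u≢v) ∘ Equivalence.to e)

      indicates : ∀ {u v} → u ≢ v → Indicates (Adj u v) (gram L u v)
      indicates u≢v = Equivalence.to (odd⇔adj u≢v) , λ ¬uv → ¬-not (¬uv ∘ Equivalence.from (odd⇔adj u≢v))


-- The three numbers of a forest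

open import Data.Nat.Base using (_+_)

theorem4p16 : ∀ {c ℓ₁ ℓ₂} (n : ℕ) (F : Graph n) → IsForest F →
    (𝔽 : HeytingField c ℓ₁ ℓ₂) →
    ∃[ c₂ ] ∃[ mr ] ∃[ p ]
    (IsComplementationNumber F c₂ ×
    LinearAlgebra.IsMinimumRank 𝔽 F mr ×
    IsPathCoverNumber F p ×
    c₂ ≡ mr ×
    mr + p ≡ n)
theorem4p16 n F forest 𝔽 with Peelings.peeling F forest n (allFin n) (ℕ.≤-reflexive (length-tabulate _)) (allFin⁺ n)
... | k , p , d =
  k , k , p ,
  Complementation.complementationNumber F d ,
  Gram.minimumRank 𝔽 F d ,
  -- A cover by j paths gives n ≤ j + k; as n is p + k, cancelling k leaves p ≤ j.
  (Chains.pathCover F d , λ j cover →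
    ℕ.+-cancelʳ-≤ k p j (ℕ.≤-trans (ℕ.≤-reflexive (trans (ℕ.+-comm p k) k+p≡n))
      (Counting.pathCover-bound F d cover))) ,
  refl ,
  k+p≡n
  where
  k+p≡n : k + p ≡ n
  k+p≡n = trans (sym (Peelings.peeling-length F d)) (length-tabulate _)
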